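{- Let $L$ be a countable metric signature and $\Omega$ a weak modulus. Let $A, B$ be separable $L$-structures, let $n\in\mathbb N$ and let $\bar a \in A^n$, $\bar b \in B^n$. Then, for any ordinal $\alpha < \omega_1$, $$r_\alpha(A \bar a, B \bar b) = \sup_\phi |\phi^A(\bar a) - \phi^B(\bar b)|,$$ where the supremum is taken over all $n$-ary $\Omega$-formulas $\phi$ of quantifier rank at most $\alpha$.
   Context: Moduli. For $n\in\mathbb N$ or $n=\mathbb N$, an $n$-ary modulus is a continuous function $\Delta:[0,\infty)^n\to[0,\infty)$ with $\Delta(0)=0$ and $\Delta(\delta)\le\Delta(\delta+\delta')\le\Delta(\delta)+\Delta(\delta')$. A weak modulus is a function $\Omega:[0,\infty)^{\mathbb N}\to[0,\infty]$ with $\Omega(0)=0$ and $\Omega(\delta)\le\Omega(\delta+\delta')\le\Omega(\delta)+\Omega(\delta')$ that is lower semicontinuous for the product topology and separately continuous in each argument; put $\Omega|_n(\delta_0,\dots,\delta_{n-1})=\Omega(\delta_0,\dots,\delta_{n-1},0,0,\dots)$. A map $f$ from a product of metric spaces $\prod_{i<n}X_i$ to a metric space respects $\Delta$ if $d(f(x),f(y))\le\Delta((d(x_i,y_i))_{i<n})$ for all $x,y$. Signatures and structures. A metric signature $L$ is a set of function and predicate symbols; each symbol $s$ has an arity $n_s$ and an $n_s$-ary modulus $\Delta_s$, and each predicate symbol $P$ also has a compact interval $I_P\subseteq\mathbb R$ (its bound). $L$ always contains a binary predicate symbol $d$ with $\Delta_d(\delta_1,\delta_2)=\delta_1+\delta_2$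 and some bound. An $L$-structure $A$ is a complete metric space with maps $F^A:A^{n_F}\to A$ respecting $\Delta_F$ and functions $P^A:A^{n_P}\to I_P$ respecting $\Delta_P$, where $d$ is interpreted as the distance. Formulas. Variables are $x_0,x_1,\dots$. Terms and formulas carry moduli, formulas also carry bounds: $\Delta_{x_i}(\delta)=\delta_i$; $\Delta_{F(\bar\tau)}=\Delta_F\circ(\Delta_{\tau_i})_i$; an atomic formula $P(\bar\tau)$ has modulus $\Delta_P\circ(\Delta_{\tau_i})_i$ and bound $I_P$. If $f:\prod_i I_{\phi_i}\to\mathbb R$ is continuous, $f(\phi_0,\dots,\phi_{m-1})$ has modulus $\Delta_f\circ(\Delta_{\phi_i})_i$ and bound $f(\prod_i I_{\phi_i})$, where $\Delta_f(\delta)=\sup\{|f(x)-f(y)|:|x_i-y_i|\le\delta_i\}$; it is called a basic formula if all $\phi_i$ are atomic. A formula with modulus $\Delta$ and bound $I$ respects any $\Delta'\ge\Delta$ and $I'\supseteq I$. $\phi^A$ denotes the interpretation of $\phi$ in $A$; $\bigvee_i,\bigwedge_i$ (countable) are interpreted as $\sup_i,\inf_i$. $\Omega$-formulas. For a compact interval $I$, $n$-ary $(\Omega,I)$-formulas are defined inductively: (1) basic formulas depending only on $x_0,\dots,x_{n-1}$ that respect $\Omega|_n$ and $I$; (2) $\bigvee_{i\in\mathbb N}\phi_i$ and $\bigwedge_{i\in\mathbb N}\phi_i$ for $n$-ary $(\Omega,I)$-formulas $\phi_i$; (3) $\inf_{x_n}\phi$ and $\sup_{x_n}\phi$ for an $(n+1)$-ary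 $(\Omega,I)$-formula $\phi$; (4) if $\phi_0,\dots,\phi_{k-1}$ are $n$-ary $(\Omega,I)$-formulas and $f:\mathbb R^k\to\mathbb R$ is 1-Lipschitz for the max distance, $f(\phi_0,\dots,\phi_{k-1})$ is an $n$-ary $(\Omega,f(I^k))$-formula. An $n$-ary $\Omega$-formula is an $n$-ary $(\Omega,I)$-formula for some $I$. Quantifier rank: $0$ for atomic formulas; $\operatorname{qr}f(\phi_0,\dots,\phi_{m-1})=\max_i\operatorname{qr}\phi_i$; $\operatorname{qr}\bigvee_i\phi_i=\operatorname{qr}\bigwedge_i\phi_i=\sup_i\operatorname{qr}\phi_i$; $\operatorname{qr}\sup_x\phi=\operatorname{qr}\inf_x\phi=\operatorname{qr}\phi+1$. Back-and-forth pseudo-distances (with respect to $\Omega$), with values in $[0,\infty]$, for $\bar a\in A^n,\bar b\in B^n$: $r_0(A\bar a,B\bar b)=\sup_\phi|\phi^A(\bar a)-\phi^B(\bar b)|$ over all basic $n$-ary $\Omega$-formulas $\phi$; $r_\alpha=\sup_{\beta<\alpha}r_\beta$ for $\alpha$ limit; $r_{\alpha+1}(A\bar a,B\bar b)=\sup_{c\in A,d\in B}\inf_{c'\in A,d'\in B}\max\bigl(r_\alpha(A\bar ac,B\bar bd'),r_\alpha(A\bar ac',B\bar bd)\bigr)$. -}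

module Defs where

open import Algebra.Structures using (IsCommutativeRing)
open import Axiom.ExcludedMiddle using (ExcludedMiddle)
open import Data.Fin.Base using (Fin; zero; suc; fromℕ; fromℕ<)
open import Data.Nat.Base as ℕ using (ℕ; zero; suc)
open import Data.Nat.Properties as ℕ using (_≟_; _<?_)
open import Data.Product.Base using (Σ; Σ-syntax; ∃; ∃-syntax; _×_; _,_; proj₁; proj₂)
open import Data.Sum.Base using (_⊎_; inj₁; inj₂)
open import Data.Vec.Functional using (foldr; insertAt)
open import Function.Base using (_on_; flip)
open import Function.Bundles using (_⇔_; _↣_; Equivalence)
open import Function.Metric.Structures using (IsGeneralMetric)
open import Induction.WellFounded using (Acc; acc; WellFounded)
open import Level using (0ℓ)
open import Relation.Binary.Bundles using (TotalOrder)
open import Relation.Binary.Core using (Rel)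
open import Relation.Binary.PropositionalEquality.Core using (subst; sym)
open import Relation.Binary.Structures using (IsTotalOrder)
import Relation.Binary.Construct.On as On
open import Relation.Nullary.Decidable.Core using (Dec; yes; no)
open import Relation.Nullary.Negation.Core using (¬_; contradiction)
open import Relation.Nullary.Construct.Add.Supremum using (_⁺; [_]; ⊤⁺)
import Algebra.Construct.NaturalChoice.Max as Max
import Relation.Binary.Construct.Add.Supremum.Equality as SupEq
import Relation.Binary.Construct.Add.Supremum.NonStrict as SupNonStrict
import Relation.Binary.Construct.Add.Supremum.Strict as SupStrict
import Relation.Binary.Construct.NonStrictToStrict as ToStrict

IsSup : {V : Set} → Rel V 0ℓ → {X : Set} → (X → V) → V → Set
IsSup _≤_ F s = (∀ x → F x ≤ s) × (∀ u → (∀ x → F x ≤ u) → s ≤ u)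

IsInf : {V : Set} → Rel V 0ℓ → {X : Set} → (X → V) → V → Set
IsInf _≤_ = IsSup (flip _≤_)

-- The real numbers, given axiomatically.  There are no quotient types, so the
-- field is a setoid; Dedekind completeness is stated for families, a subset P
-- being the family proj₁ : ∃ P → ℝ.
record CompleteOrderedField : Set₁ where
  infix  4 _≈_ _≤_
  infixl 6 _+_
  infixl 7 _*_
  infix  8 -_
  field
    ℝ                 : Set
    _≈_ _≤_           : Rel ℝ 0ℓ
    _+_ _*_           : ℝ → ℝ → ℝ
    -_                : ℝ → ℝ
    0# 1#             : ℝ
    isCommutativeRing : IsCommutativeRing _≈_ _+_ _*_ -_ 0# 1#
    0≉1               : ¬ (0# ≈ 1#)
    inverse           : ∀ x → ¬ (x ≈ 0#) → ∃[ y ] (x * y ≈ 1#)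
    isTotalOrder      : IsTotalOrder _≈_ _≤_
    +-monoˡ-≤         : ∀ z {x y} → x ≤ y → x + z ≤ y + z
    *-nonNegative     : ∀ {x y} → 0# ≤ x → 0# ≤ y → 0# ≤ x * y
    complete          : {X : Set} (F : X → ℝ) → X →
                        (∃[ u ] ∀ x → F x ≤ u) → ∃ (IsSup _≤_ F)

-- Brouwer trees: sup f is the supremum of an arbitrary sequence.  Up to _≈ₒ_
-- they are, classically, exactly the ordinals below ω₁.
data Ord : Set where
  zero : Ord
  suc  : Ord → Ord
  sup  : (ℕ → Ord) → Ord

infix 4 _≤ₒ_ _<ₒ_ _≈ₒ_

data _≤ₒ_ : Ord → Ord → Set where
  z≤    : ∀ {α} → zero ≤ₒ α
  s≤s   : ∀ {α β} → α ≤ₒ β → suc α ≤ₒ suc β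
  ≤-sup : ∀ {α f} k → α ≤ₒ f k → α ≤ₒ sup f
  sup-≤ : ∀ {f β} → (∀ k → f k ≤ₒ β) → sup f ≤ₒ β

_<ₒ_ _≈ₒ_ : Ord → Ord → Set
α <ₒ β = suc α ≤ₒ β
α ≈ₒ β = α ≤ₒ β × β ≤ₒ α

_⊔ₒ_ : Ord → Ord → Ord
α ⊔ₒ β = sup λ { zero → α ; (suc _) → β }

≤ₒ-trans : ∀ {α β γ} → α ≤ₒ β → β ≤ₒ γ → α ≤ₒ γ
≤ₒ-trans z≤          q           = z≤
≤ₒ-trans (sup-≤ p)   q           = sup-≤ λ k → ≤ₒ-trans (p k) q
≤ₒ-trans (s≤s p)     (s≤s q)     = s≤s (≤ₒ-trans p q)
≤ₒ-trans (s≤s p)     (≤-sup k q) = ≤-sup k (≤ₒ-trans (s≤s p) q)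
≤ₒ-trans (≤-sup k p) (sup-≤ q)   = ≤ₒ-trans p (q k)
≤ₒ-trans (≤-sup k p) (≤-sup j q) = ≤-sup j (≤ₒ-trans (≤-sup k p) q)

<ₒ-wellFounded : WellFounded _<ₒ_
<ₒ-wellFounded α = acc (below α)
  where
  below : ∀ α {β} → β <ₒ α → Acc _<ₒ_ β
  below (suc α) (s≤s β≤α)     = acc λ γ<β → below α (≤ₒ-trans γ<β β≤α)
  below (sup f) (≤-sup k β<f) = below (f k) β<f

-- Since Dec P carries an element of P, em also yields the choice principles of
-- classical mathematics.
module MetricLogic (em : ExcludedMiddle 0ℓ) (R : CompleteOrderedField) where

  open CompleteOrderedField R public
  open IsTotalOrder isTotalOrder
    using ()
    renaming (refl to ≤-refl; trans to ≤-trans)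

  open ToStrict _≈_ _≤_ public using (_<_)

  infixl 6 _-_
  _-_ : ℝ → ℝ → ℝ
  x - y = x + (- y)

  ℝ-totalOrder : TotalOrder 0ℓ 0ℓ 0ℓ
  ℝ-totalOrder = record { isTotalOrder = isTotalOrder }

  open Max ℝ-totalOrder public using (_⊔_)

  ∣_∣ : ℝ → ℝ
  ∣ x ∣ = x ⊔ (- x)

  ℝ≥0 : Set
  ℝ≥0 = ∃ λ x → 0# ≤ x

  infix 4 _≈₊_ _≤₊_ _<₊_
  _≈₊_ _≤₊_ _<₊_ : Rel ℝ≥0 0ℓ
  _≈₊_ = _≈_ on proj₁
  _≤₊_ = _≤_ on proj₁
  _<₊_ = _<_ on proj₁

  0₊ : ℝ≥0
  0₊ = 0# , ≤-refl

  infixl 6 _+₊_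
  _+₊_ : ℝ≥0 → ℝ≥0 → ℝ≥0
  (x , 0≤x) +₊ (y , 0≤y) = x + y , ≤-trans 0≤y
      (≤-trans (IsTotalOrder.reflexive isTotalOrder (CR.sym (CR.+-identityˡ y)))
               (+-monoˡ-≤ y 0≤x))
    where module CR = IsCommutativeRing isCommutativeRing

  ∣_∣₊ : ℝ → ℝ≥0
  ∣ x ∣₊ = ∣ x ∣ , 0≤∣x∣
    where
    module O  = IsTotalOrder isTotalOrder
    module CR = IsCommutativeRing isCommutativeRing
    open Max ℝ-totalOrder using (x≤x⊔y; x≤y⊔x)
    0≤∣x∣ : 0# ≤ ∣ x ∣
    0≤∣x∣ with O.total 0# x
    ... | inj₁ 0≤x = ≤-trans 0≤x (x≤x⊔y x (- x))
    ... | inj₂ x≤0 = ≤-trans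
      (≤-trans (O.reflexive (CR.sym (CR.-‿inverseʳ x)))
      (≤-trans (+-monoˡ-≤ (- x) x≤0) (O.reflexive (CR.+-identityˡ (- x)))))
      (x≤y⊔x x (- x))

  ℝ∞ : Set
  ℝ∞ = ℝ≥0 ⁺

  open SupEq _≈₊_ public renaming (_≈⁺_ to _≈∞_) using ()
  open SupNonStrict _≤₊_ public renaming (_≤⁺_ to _≤∞_) using ([_]; _≤⊤⁺)
  open SupStrict _<₊_ public renaming (_<⁺_ to _<∞_) using ()

  ℝ∞-totalOrder : TotalOrder 0ℓ 0ℓ 0ℓ
  ℝ∞-totalOrder = record
    { isTotalOrder = SupNonStrict.≤⁺-isTotalOrder _≤₊_
        (On.isTotalOrder proj₁ isTotalOrder) }

  open Max ℝ∞-totalOrder public using () renaming (_⊔_ to _⊔∞_)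

  infixl 6 _+∞_
  _+∞_ : ℝ∞ → ℝ∞ → ℝ∞
  [ x ] +∞ [ y ] = [ x +₊ y ]
  [ x ] +∞ ⊤⁺    = ⊤⁺
  ⊤⁺    +∞ y     = ⊤⁺

  inf-exists : {X : Set} (F : X → ℝ) → X → (∃[ l ] ∀ x → l ≤ F x) → ∃ (IsInf _≤_ F)
  inf-exists F x₀ (l , l≤F) =
    let s , upper , least = complete {X = ∃[ y ] ∀ x → y ≤ F x} proj₁ (l , l≤F)
                              (F x₀ , λ (y , y≤F) → y≤F x₀)
    in s , (λ x → least (F x) λ (y , y≤F) → y≤F x) , λ u u≤F → upper (u , u≤F)

  inf∞-exists : {X : Set} (F : X → ℝ∞) → ∃ (IsInf _≤∞_ F)
  inf∞-exists {X} F with em {∃[ u ] ∃[ x ] F x ≤∞ [ u ]}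
  ... | no none = ⊤⁺ , (λ x → bound x (F x) (λ u e → none (u , x , e))) , λ u _ → u ≤⊤⁺
    where
    bound : ∀ x v → (∀ u → ¬ (v ≤∞ [ u ])) → ⊤⁺ ≤∞ v
    bound x ⊤⁺    _  = ⊤⁺ ≤⊤⁺
    bound x [ v ] v≰ = contradiction [ ≤-refl ] (v≰ v)
  ... | yes (u₀ , x₀ , Fx₀≤u₀)
    with inf-exists {X = ∃[ u ] ∃[ x ] F x ≤∞ [ u ]} (λ ((u , _) , _) → u)
           (u₀ , x₀ , Fx₀≤u₀) (0# , λ ((_ , 0≤u) , _) → 0≤u)
  ... | s , lower , greatest =
    [ s , greatest 0# (λ ((_ , 0≤u) , _) → 0≤u) ] , isLower , isGreatest
    where
    isLower : ∀ x → [ s , _ ] ≤∞ F x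
    isLower x with F x in eq
    ... | ⊤⁺    = _ ≤⊤⁺
    ... | [ v ] = [ lower (v , x , F≤v) ]
      where
      F≤v : F x ≤∞ [ v ]
      F≤v = subst (_≤∞ [ v ]) (sym eq) [ ≤-refl ]
    ≤∞-trans : ∀ {u v w} → u ≤∞ v → v ≤∞ w → u ≤∞ w
    ≤∞-trans = SupNonStrict.≤⁺-trans _≤₊_ ≤-trans
    isGreatest : ∀ u → (∀ x → u ≤∞ F x) → u ≤∞ [ s , _ ]
    isGreatest ⊤⁺    u≤F with () ← ≤∞-trans (u≤F x₀) Fx₀≤u₀
    isGreatest [ u ] u≤F = [ greatest (proj₁ u) (λ (v , x , F≤v) →
      SupNonStrict.[≤]-injective _≤₊_ (≤∞-trans (u≤F x) F≤v)) ]

  sup∞-exists : {X : Set} (F : X → ℝ∞) → ∃ (IsSup _≤∞_ F)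
  sup∞-exists F =
    let s , lower , greatest = inf∞-exists {X = ∃[ u ] ∀ x → F x ≤∞ u} proj₁
    in s , (λ x → greatest (F x) λ (u , F≤u) → F≤u x) , λ u F≤u → lower (u , F≤u)

  ⨆ ⨅ : {X : Set} → (X → ℝ∞) → ℝ∞
  ⨆ F = proj₁ (sup∞-exists F)
  ⨅ F = proj₁ (inf∞-exists F)

  record Interval : Set where
    field
      lo hi : ℝ
      lo≤hi : lo ≤ hi

  infix 4 _∈_
  _∈_ : ℝ → Interval → Set
  x ∈ I = lo ≤ x × x ≤ hi
    where open Interval I

  sup-in inf-in : {X : Set} (I : Interval) → X → (X → ∃ (_∈ I)) → ∃ (_∈ I)
  sup-in I x₀ F =
    let s , upper , least = complete (λ x → proj₁ (F x)) x₀ (hi , λ x → proj₂ (proj₂ (F x)))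
    in s , ≤-trans (proj₁ (proj₂ (F x₀))) (upper x₀) , least hi λ x → proj₂ (proj₂ (F x))
    where open Interval I
  inf-in I x₀ F =
    let s , lower , greatest = inf-exists (λ x → proj₁ (F x)) x₀ (lo , λ x → proj₁ (proj₂ (F x)))
    in s , greatest lo (λ x → proj₁ (proj₂ (F x))) , ≤-trans (lower x₀) (proj₂ (proj₂ (F x₀)))
    where open Interval I

  Continuous : ∀ {m} (S : Fin m → ℝ → Set) → ((∀ i → ∃ (S i)) → ℝ) → Set
  Continuous S f = ∀ x ε → 0# < ε → ∃[ δ ] 0# < δ × (∀ y →
    (∀ i → ∣ proj₁ (x i) - proj₁ (y i) ∣ < δ) → ∣ f x - f y ∣ < ε)

  OneLipschitz : ∀ {k} → ((Fin k → ℝ) → ℝ) → Set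
  OneLipschitz f = ∀ x y → ∣ f x - f y ∣ ≤ foldr _⊔_ 0# (λ i → ∣ x i - y i ∣)

  record Modulus (n : ℕ) : Set where
    field
      Δ           : (Fin n → ℝ≥0) → ℝ≥0
      continuous  : Continuous (λ _ → 0# ≤_) (λ δ → proj₁ (Δ δ))
      vanishes    : Δ (λ _ → 0₊) ≈₊ 0₊
      monotone    : ∀ (δ δ′ : Fin n → ℝ≥0) → Δ δ ≤₊ Δ (λ i → δ i +₊ δ′ i)
      subadditive : ∀ (δ δ′ : Fin n → ℝ≥0) → Δ (λ i → δ i +₊ δ′ i) ≤₊ Δ δ +₊ Δ δ′

  _[_≔_] : (ℕ → ℝ≥0) → ℕ → ℝ≥0 → ℕ → ℝ≥0
  (δ [ i ≔ t ]) j with j ≟ i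
  ... | yes _ = t
  ... | no  _ = δ j

  -- Continuity into [0,∞] refers to its order topology, with subbasis the open
  -- rays (s,∞] and [0,s).
  record WeakModulus : Set where
    field
      Ω                    : (ℕ → ℝ≥0) → ℝ∞
      vanishes             : Ω (λ _ → 0₊) ≈∞ [ 0₊ ]
      monotone             : ∀ (δ δ′ : ℕ → ℝ≥0) → Ω δ ≤∞ Ω (λ i → δ i +₊ δ′ i)
      subadditive          : ∀ (δ δ′ : ℕ → ℝ≥0) → Ω (λ i → δ i +₊ δ′ i) ≤∞ Ω δ +∞ Ω δ′
      lowerSemicontinuous  : ∀ δ s → [ s ] <∞ Ω δ → ∃[ N ] ∃[ ε ] 0# < ε × (∀ δ′ →
        (∀ i → i ℕ.< N → ∣ proj₁ (δ i) - proj₁ (δ′ i) ∣ < ε) → [ s ] <∞ Ω δ′)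
      separatelyContinuous : ∀ δ i t s →
        ([ s ] <∞ Ω (δ [ i ≔ t ]) → ∃[ ε ] 0# < ε × (∀ t′ →
          ∣ proj₁ t - proj₁ t′ ∣ < ε → [ s ] <∞ Ω (δ [ i ≔ t′ ]))) ×
        (Ω (δ [ i ≔ t ]) <∞ [ s ] → ∃[ ε ] 0# < ε × (∀ t′ →
          ∣ proj₁ t - proj₁ t′ ∣ < ε → Ω (δ [ i ≔ t′ ]) <∞ [ s ]))

  extend : ∀ {n} → (Fin n → ℝ≥0) → ℕ → ℝ≥0
  extend {n} δ i with i <? n
  ... | yes i<n = δ (fromℕ< i<n)
  ... | no  _   = 0₊

  _∣_ : WeakModulus → (n : ℕ) → (Fin n → ℝ≥0) → ℝ∞
  (Ω ∣ n) δ = WeakModulus.Ω Ω (extend δ)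

  record Signature : Set₁ where
    field
      Fun Pred    : ℕ → Set                       -- indexed by arity
      funModulus  : ∀ {k} → Fun k → Modulus k
      predModulus : ∀ {k} → Pred k → Modulus k
      bound       : ∀ {k} → Pred k → Interval
      𝐝           : Pred 2
      𝐝-modulus   : ∀ δ → Modulus.Δ (predModulus 𝐝) δ ≈₊ δ zero +₊ δ (suc zero)

  Countable : Signature → Set
  Countable L = (∃ Fun ⊎ ∃ Pred) ↣ ℕ
    where open Signature L

  -- Structures are nonempty; otherwise sup_x and inf_x have no value.
  record Structure (L : Signature) : Set₁ where
    open Signature L
    infix 4 _≈ₐ_
    field
      Carrier      : Set
      _≈ₐ_         : Rel Carrier 0ℓ
      d            : Carrier → Carrier → ℝ≥0
      isMetric     : IsGeneralMetric _≈ₐ_ _≈₊_ _≤₊_ 0₊ _+₊_ d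
      isComplete   : (s : ℕ → Carrier) →
        (∀ ε → 0# < ε → ∃[ N ] ∀ i j → N ℕ.≤ i → N ℕ.≤ j → proj₁ (d (s i) (s j)) < ε) →
        ∃[ x ] ∀ ε → 0# < ε → ∃[ N ] ∀ i → N ℕ.≤ i → proj₁ (d (s i) x) < ε
      inhabitant   : Carrier
      fun          : ∀ {k} → Fun k → (Fin k → Carrier) → Carrier
      pred         : ∀ {k} (P : Pred k) → (Fin k → Carrier) → ∃ (_∈ bound P)
      fun-respects : ∀ {k} (F : Fun k) x y →
        d (fun F x) (fun F y) ≤₊ Modulus.Δ (funModulus F) (λ i → d (x i) (y i))
      pred-respects : ∀ {k} (P : Pred k) x y →
        ∣ proj₁ (pred P x) - proj₁ (pred P y) ∣₊
          ≤₊ Modulus.Δ (predModulus P) (λ i → d (x i) (y i))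
      𝐝-isDistance : ∀ x → proj₁ (pred 𝐝 x) ≈ proj₁ (d (x zero) (x (suc zero)))

  open Structure using (Carrier)

  Separable : ∀ {L} → Structure L → Set
  Separable A = Σ[ s ∈ (ℕ → Carrier A) ]
    ∀ x ε → 0# < ε → ∃[ k ] proj₁ (Structure.d A (s k) x) < ε

  module _ (L : Signature) where
    open Signature L

    -- Terms in the variables x₀, …, xₙ₋₁ only.
    data Term (n : ℕ) : Set where
      var : Fin n → Term n
      app : ∀ {k} → Fun k → (Fin k → Term n) → Term n

    record Atomic (n : ℕ) : Set where
      field
        {arity} : ℕ
        symbol  : Pred arity
        args    : Fin arity → Term n

    atomicBound : ∀ {n} → Atomic n → Interval
    atomicBound φ = bound (Atomic.symbol φ)

    record Basic (n : ℕ) : Set where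
      field
        {width}    : ℕ
        atoms      : Fin width → Atomic n
      Domain : Fin width → ℝ → Set
      Domain i x = x ∈ atomicBound (atoms i)
      field
        f          : (∀ i → ∃ (Domain i)) → ℝ
        continuous : Continuous Domain f

  module _ {L : Signature} where
    open Signature L

    termModulus : ∀ {n} → Term L n → (Fin n → ℝ≥0) → ℝ≥0
    termModulus (var i)    δ = δ i
    termModulus (app F ts) δ = Modulus.Δ (funModulus F) λ i → termModulus (ts i) δ

    atomicModulus : ∀ {n} → Atomic L n → (Fin n → ℝ≥0) → ℝ≥0
    atomicModulus φ δ = Modulus.Δ (predModulus symbol) λ i → termModulus (args i) δ
      where open Atomic φ

    -- Δ_f ∘ (Δ_φᵢ)ᵢ, where Δ_f(δ) = sup { |f(x) - f(y)| : |xᵢ - yᵢ| ≤ δᵢ }.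
    basicModulus : ∀ {n} → Basic L n → (Fin n → ℝ≥0) → ℝ∞
    basicModulus φ δ = Δf λ i → atomicModulus (atoms i) δ
      where
      open Basic φ
      Δf : (Fin width → ℝ≥0) → ℝ∞
      Δf ε = ⨆ {X = Σ[ x ∈ (∀ i → ∃ (Domain i)) ] Σ[ y ∈ (∀ i → ∃ (Domain i)) ]
                      (∀ i → ∣ proj₁ (x i) - proj₁ (y i) ∣₊ ≤₊ ε i)}
                λ (x , y , _) → [ ∣ f x - f y ∣₊ ]

    RespectsModulus : ∀ {n} → WeakModulus → Basic L n → Set
    RespectsModulus {n} Ω φ = ∀ δ → basicModulus φ δ ≤∞ (Ω ∣ n) δ

    RespectsBound : ∀ {n} → Interval → Basic L n → Set
    RespectsBound I φ = ∀ x → Basic.f φ x ∈ I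

  IsImage : ∀ {k} → ((Fin k → ℝ) → ℝ) → Interval → Interval → Set
  IsImage f I J = ∀ y → (y ∈ J) ⇔ (∃[ x ] (∀ i → x i ∈ I) × y ≈ f x)

  -- Formula L Ω n I is the type of n-ary (Ω,I)-formulas; the quantifiers bind
  -- the last variable xₙ.
  data Formula (L : Signature) (Ω : WeakModulus) (n : ℕ) (I : Interval) : Set where
    basic     : (φ : Basic L n) → RespectsModulus Ω φ → RespectsBound I φ → Formula L Ω n I
    ⋁ ⋀       : (ℕ → Formula L Ω n I) → Formula L Ω n I
    inf′ sup′ : Formula L Ω (suc n) I → Formula L Ω n I
    lipschitz : ∀ {k J} (f : (Fin k → ℝ) → ℝ) → OneLipschitz f → IsImage f J I →
                (Fin k → Formula L Ω n J) → Formula L Ω n I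

  qr : ∀ {L Ω n I} → Formula L Ω n I → Ord
  qr (basic _ _ _)        = zero
  qr (⋁ φ)                = sup λ i → qr (φ i)
  qr (⋀ φ)                = sup λ i → qr (φ i)
  qr (inf′ φ)             = suc (qr φ)
  qr (sup′ φ)             = suc (qr φ)
  qr (lipschitz _ _ _ φs) = foldr _⊔ₒ_ zero λ i → qr (φs i)

  infixl 5 _∷ʳ_
  _∷ʳ_ : ∀ {X : Set} {n} → (Fin n → X) → X → Fin (suc n) → X
  _∷ʳ_ {n = n} a c = insertAt a (fromℕ n) c

  module _ {L : Signature} (A : Structure L) where
    open Structure A using (fun; pred; inhabitant)

    ⟦_⟧ₜ : ∀ {n} → Term L n → (Fin n → Carrier A) → Carrier A
    ⟦ var i ⟧ₜ    a = a i
    ⟦ app F ts ⟧ₜ a = fun F λ i → ⟦ ts i ⟧ₜ a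

    ⟦_⟧ₐ : ∀ {n} (φ : Atomic L n) → (Fin n → Carrier A) → ∃ (_∈ atomicBound L φ)
    ⟦ φ ⟧ₐ a = pred symbol λ i → ⟦ args i ⟧ₜ a
      where open Atomic φ

    ⟦_⟧ᵇ : ∀ {n} → Basic L n → (Fin n → Carrier A) → ℝ
    ⟦ φ ⟧ᵇ a = f λ i → ⟦ atoms i ⟧ₐ a
      where open Basic φ

    ⟦_⟧ : ∀ {Ω n I} → Formula L Ω n I → (Fin n → Carrier A) → ∃ (_∈ I)
    ⟦ basic φ _ φ∈I ⟧              a = ⟦ φ ⟧ᵇ a , φ∈I _
    ⟦_⟧ {I = I} (⋁ φ)              a = sup-in I zero λ i → ⟦ φ i ⟧ a
    ⟦_⟧ {I = I} (⋀ φ)              a = inf-in I zero λ i → ⟦ φ i ⟧ a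
    ⟦_⟧ {I = I} (inf′ φ)           a = inf-in I inhabitant λ c → ⟦ φ ⟧ (a ∷ʳ c)
    ⟦_⟧ {I = I} (sup′ φ)           a = sup-in I inhabitant λ c → ⟦ φ ⟧ (a ∷ʳ c)
    ⟦ lipschitz f _ isImage φs ⟧   a =
      f x , Equivalence.from (isImage (f x))
              (x , (λ i → proj₂ (⟦ φs i ⟧ a)) , IsTotalOrder.Eq.refl isTotalOrder)
      where
      x : Fin _ → ℝ
      x i = proj₁ (⟦ φs i ⟧ a)

  module BackAndForth {L : Signature} (Ω : WeakModulus) (A B : Structure L) where

    Distance : Set
    Distance = ∀ n → (Fin n → Carrier A) → (Fin n → Carrier B) → ℝ∞

    r₀ : Distance
    r₀ n a b =
      ⨆ {X = Σ[ φ ∈ Basic L n ] RespectsModulus Ω φ × (∃[ I ] RespectsBound I φ)}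
        λ (φ , _) → [ ∣ ⟦ A ⟧ᵇ φ a - ⟦ B ⟧ᵇ φ b ∣₊ ]

    next : Distance → Distance
    next r n a b = ⨆ λ ((c , d) : Carrier A × Carrier B) →
                   ⨅ λ ((c′ , d′) : Carrier A × Carrier B) →
      r (suc n) (a ∷ʳ c) (b ∷ʳ d′) ⊔∞ r (suc n) (a ∷ʳ c′) (b ∷ʳ d)

    -- The two decisions are α ≈ 0 and α ≈ suc β for some β; failing both, α is
    -- a limit.
    step : ∀ α → (∀ {β} → β <ₒ α → Distance) →
           Dec (α ≈ₒ zero) → Dec (∃[ β ] α ≈ₒ suc β) → Distance
    step α rec (yes _) _                         = r₀
    step α rec (no _)  (yes (β , α≤sβ , sβ≤α))   = next (rec sβ≤α)
    step α rec (no _)  (no _)              n a b =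
      ⨆ λ ((β , β<α) : ∃[ β ] β <ₒ α) → rec β<α n a b

    r-acc : ∀ α → Acc _<ₒ_ α → Distance
    r-acc α (acc rs) = step α (λ β<α → r-acc _ (rs β<α)) em em

    r : Ord → Distance
    r α = r-acc α (<ₒ-wellFounded α)

{-# OPTIONS --safe #-}
module Submission where

-- Both sides are compared by induction on α, uniformly in n, ā, b̄.  Formulas
-- never separate more than r_α does: connectives do not increase the gap
-- |φ(ā) - φ(b̄)|, a quantifier is answered by the inner infimum of r_{β+1}, and
-- a basic formula survives to higher levels by adding a dummy variable.
-- Conversely, suppose r_β(āc, b̄d) > t for some c and all d.  Choose for each dᵢ
-- in a dense sequence of B a formula φᵢ of rank ≤ β with
-- |φᵢ(āc) - φᵢ(b̄dᵢ)| ≥ t.  Then χᵢ = min(t, |φᵢ - φᵢ(āc)|) vanishes at āc and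
-- equals t at b̄dᵢ, and since Ω-formulas respect Ω, which is continuous in the
-- last argument, ⋁ᵢ χᵢ ≥ t at b̄d for every d.  So inf_x ⋁ᵢ χᵢ, of rank ≤ β + 1,
-- separates ā and b̄ by t.

open import Defs
open import Algebra.Bundles using (CommutativeRing)
open import Axiom.ExcludedMiddle using (ExcludedMiddle)
open import Data.Fin.Base using (Fin; zero; suc; inject₁; toℕ)
open import Data.Fin.Properties using (fromℕ<-toℕ; toℕ-fromℕ<; toℕ-inject₁; toℕ<n)
open import Data.Nat.Base as ℕ using (ℕ; zero; suc)
open import Data.Nat.Properties as ℕ using (_≟_; _<?_)
open import Data.Product.Base
  using (Σ-syntax; ∃; ∃-syntax; _×_; _,_; proj₁; proj₂; map₂)
open import Data.Sum.Base using (_⊎_; inj₁; inj₂)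
open import Data.Vec.Functional using (foldr)
open import Function.Base using (_∘_)
open import Function.Bundles using (mk⇔)
open import Function.Metric.Structures using (module IsGeneralMetric)
open import Induction.WellFounded using (Acc; acc)
open import Level using (0ℓ)
open import Relation.Binary.Bundles using (TotalOrder)
open import Relation.Binary.PropositionalEquality.Core using (_≡_; refl; sym; trans; cong; subst)
open import Relation.Nullary.Construct.Add.Supremum using ([_]; ⊤⁺)
open import Relation.Nullary.Decidable.Core using (Dec; yes; no)
open import Relation.Nullary.Negation.Core using (¬_; contradiction)
import Algebra.Construct.NaturalChoice.Max as Max
import Algebra.Construct.NaturalChoice.Min as Min
import Algebra.Properties.AbelianGroup as AbelianGroupProperties
import Algebra.Properties.Ring as RingProperties
import Relation.Binary.Construct.Add.Supremum.NonStrict as SupNonStrict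
import Relation.Binary.Construct.Add.Supremum.Strict as SupStrict
import Relation.Binary.Properties.TotalOrder as TotalOrderProperties

-- Order of the countable ordinals

≤ₒ-refl : ∀ {α} → α ≤ₒ α
≤ₒ-refl {zero}  = z≤
≤ₒ-refl {suc α} = s≤s ≤ₒ-refl
≤ₒ-refl {sup f} = sup-≤ λ k → ≤-sup k ≤ₒ-refl

≤ₒ-suc : ∀ {α} → α ≤ₒ suc α
≤ₒ-suc {zero}  = z≤
≤ₒ-suc {suc α} = s≤s ≤ₒ-suc
≤ₒ-suc {sup f} = sup-≤ λ k → ≤ₒ-trans ≤ₒ-suc (s≤s (≤-sup k ≤ₒ-refl))

sup-≤⁻¹ : ∀ {f α} → sup f ≤ₒ α → ∀ k → f k ≤ₒ α
sup-≤⁻¹ f≤α k = ≤ₒ-trans (≤-sup k ≤ₒ-refl) f≤α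

foldr-⊔ₒ-≤⁻¹ : ∀ {k} (f : Fin k → Ord) {α} → foldr _⊔ₒ_ zero f ≤ₒ α → ∀ i → f i ≤ₒ α
foldr-⊔ₒ-≤⁻¹ f f≤α zero    = sup-≤⁻¹ f≤α 0
foldr-⊔ₒ-≤⁻¹ f f≤α (suc i) = foldr-⊔ₒ-≤⁻¹ (f ∘ suc) (sup-≤⁻¹ f≤α 1) i

-- Classical logic and comparability of ordinals

module Classical (em : ExcludedMiddle 0ℓ) where

  ¬∀⇒∃¬ : {X : Set} {P : X → Set} → ¬ (∀ x → P x) → ∃[ x ] ¬ P x
  ¬∀⇒∃¬ {X} {P} ¬all with em {∃[ x ] ¬ P x}
  ... | yes found = found
  ... | no none   = contradiction (λ x → holds x em) ¬all
    where
    holds : ∀ x → Dec (P x) → P x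
    holds x (yes p) = p
    holds x (no ¬p) = contradiction (x , ¬p) none

  -- For a `sup`, excluded middle asks whether one of its terms already decides the comparison; if
  -- none does, comparing each term recursively bounds them all.
  ≤ₒ-<ₒ-connex : ∀ α β → α ≤ₒ β ⊎ β <ₒ α
  ≤ₒ-<ₒ-connex zero    β       = inj₁ z≤
  ≤ₒ-<ₒ-connex (suc α) zero    = inj₂ (s≤s z≤)
  ≤ₒ-<ₒ-connex (suc α) (suc β) with ≤ₒ-<ₒ-connex α β
  ... | inj₁ α≤β = inj₁ (s≤s α≤β)
  ... | inj₂ β<α = inj₂ (s≤s β<α)
  ≤ₒ-<ₒ-connex (suc α) (sup g) with em {∃[ k ] α <ₒ g k}
  ... | yes (k , α<gₖ) = inj₁ (≤-sup k α<gₖ)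
  ... | no none        = inj₂ (s≤s (sup-≤ g≤α))
    where
    g≤α : ∀ k → g k ≤ₒ α
    g≤α k with ≤ₒ-<ₒ-connex (suc α) (g k)
    ... | inj₁ α<gₖ         = contradiction (k , α<gₖ) none
    ... | inj₂ (s≤s gₖ≤α)   = gₖ≤α
  ≤ₒ-<ₒ-connex (sup f) β with em {∃[ k ] β <ₒ f k}
  ... | yes (k , β<fₖ) = inj₂ (≤-sup k β<fₖ)
  ... | no none        = inj₁ (sup-≤ f≤β)
    where
    f≤β : ∀ k → f k ≤ₒ β
    f≤β k with ≤ₒ-<ₒ-connex (f k) β
    ... | inj₁ fₖ≤β = fₖ≤β
    ... | inj₂ β<fₖ = contradiction (k , β<fₖ) none

-- Arithmetic and absolute values in the real field

module Reals (em : ExcludedMiddle 0ℓ) (R : CompleteOrderedField) where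

  open MetricLogic em R
  open Classical em
  open TotalOrder ℝ-totalOrder public
    using (antisym; total; reflexive; module Eq)
    renaming (refl to ≤-refl; trans to ≤-trans)
  open TotalOrderProperties ℝ-totalOrder public using (≰⇒>; <⇒≱)
  open Max ℝ-totalOrder public using (⊔-lub; ⊔-cong; ⊔-sel; x≤x⊔y; x≤y⊔x)
  open Min ℝ-totalOrder public using (_⊓_; ⊓-glb; ⊓-sel; x⊓y≤x; x⊓y≤y)

  ring : CommutativeRing 0ℓ 0ℓ
  ring = record { isCommutativeRing = isCommutativeRing }

  open CommutativeRing ring public using (+-comm; +-identityˡ; -‿inverseʳ)
  open CommutativeRing ring
    using (+-assoc; +-cong; +-congˡ; +-congʳ; +-identityʳ; -‿cong; *-comm; 
           *-assoc; *-congˡ; *-identityˡ; *-identityʳ; distribˡ)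
  open AbelianGroupProperties (CommutativeRing.+-abelianGroup ring)
    public using (xyx⁻¹≈y)
  open AbelianGroupProperties (CommutativeRing.+-abelianGroup ring)
    using (⁻¹-anti-homo‿-; ⁻¹-involutive)
  open RingProperties (CommutativeRing.ring ring) using (-‿distribˡ-*; -‿distribʳ-*)

  +-monoʳ-≤ : ∀ x {y z} → y ≤ z → x + y ≤ x + z
  +-monoʳ-≤ x y≤z =
    ≤-trans (reflexive (+-comm _ _)) (≤-trans (+-monoˡ-≤ x y≤z) (reflexive (+-comm _ _)))

  x+[y-x]≈y : ∀ x y → x + (y - x) ≈ y
  x+[y-x]≈y x y = Eq.trans (Eq.sym (+-assoc x y (- x))) (xyx⁻¹≈y x y)

  x+y-y≈x : ∀ x y → x + y - y ≈ x
  x+y-y≈x x y = Eq.trans (+-assoc x y (- y)) (Eq.trans (+-congˡ (-‿inverseʳ y)) (+-identityʳ x))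

  x≤x+y : ∀ {x y} → 0# ≤ y → x ≤ x + y
  x≤x+y 0≤y = ≤-trans (reflexive (Eq.sym (+-identityʳ _))) (+-monoʳ-≤ _ 0≤y)

  x≤y+z⇒x-y≤z : ∀ {x y z} → x ≤ y + z → x - y ≤ z
  x≤y+z⇒x-y≤z x≤y+z = ≤-trans (+-monoˡ-≤ _ x≤y+z) (reflexive (xyx⁻¹≈y _ _))

  x-y≤z⇒x≤y+z : ∀ {x y z} → x - y ≤ z → x ≤ y + z
  x-y≤z⇒x≤y+z x-y≤z = ≤-trans (reflexive (Eq.sym (x+[y-x]≈y _ _))) (+-monoʳ-≤ _ x-y≤z)

  x≤y⇒0≤y-x : ∀ {x y} → x ≤ y → 0# ≤ y - x
  x≤y⇒0≤y-x x≤y = ≤-trans (reflexive (Eq.sym (-‿inverseʳ _))) (+-monoˡ-≤ _ x≤y)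

  ∣x-y∣≤z : ∀ {x y z} → x ≤ y + z → y ≤ x + z → ∣ x - y ∣ ≤ z
  ∣x-y∣≤z x≤y+z y≤x+z = ⊔-lub (x≤y+z⇒x-y≤z x≤y+z)
    (≤-trans (reflexive (⁻¹-anti-homo‿- _ _)) (x≤y+z⇒x-y≤z y≤x+z))

  x≤y+∣x-y∣ : ∀ x y → x ≤ y + ∣ x - y ∣
  x≤y+∣x-y∣ x y = x-y≤z⇒x≤y+z (x≤x⊔y _ _)

  y≤x+∣x-y∣ : ∀ x y → y ≤ x + ∣ x - y ∣
  y≤x+∣x-y∣ x y = x-y≤z⇒x≤y+z
    (≤-trans (reflexive (Eq.sym (⁻¹-anti-homo‿- x y))) (x≤y⊔x _ _))

  0≤∣_∣ : ∀ x → 0# ≤ ∣ x ∣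
  0≤∣ x ∣ = proj₂ ∣ x ∣₊

  ∣x-y∣≤∣y-x∣ : ∀ x y → ∣ x - y ∣ ≤ ∣ y - x ∣
  ∣x-y∣≤∣y-x∣ x y = ∣x-y∣≤z (y≤x+∣x-y∣ y x) (x≤y+∣x-y∣ y x)

  triangle : ∀ x y z → ∣ x - z ∣ ≤ ∣ y - z ∣ + ∣ x - y ∣
  triangle x y z = ∣x-y∣≤z
    (≤-trans (x≤y+∣x-y∣ x y) (≤-trans (+-monoˡ-≤ _ (x≤y+∣x-y∣ y z)) (reflexive (+-assoc _ _ _))))
    (≤-trans (y≤x+∣x-y∣ y z) (≤-trans (+-monoˡ-≤ _ (y≤x+∣x-y∣ x y))
      (≤-trans (reflexive (+-assoc _ _ _)) (reflexive (+-congˡ (+-comm _ _))))))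

  ∣x-y∣≤0⇒x≈y : ∀ {x y} → ∣ x - y ∣ ≤ 0# → x ≈ y
  ∣x-y∣≤0⇒x≈y {x} {y} ∣x-y∣≤0 = antisym
    (≤-trans (x≤y+∣x-y∣ x y) (≤-trans (+-monoʳ-≤ _ ∣x-y∣≤0) (reflexive (+-identityʳ _))))
    (≤-trans (y≤x+∣x-y∣ x y) (≤-trans (+-monoʳ-≤ _ ∣x-y∣≤0) (reflexive (+-identityʳ _))))

  ∣x-y∣≈z : ∀ {x y z} → 0# ≤ z → x ≈ y + z → ∣ x - y ∣ ≈ z
  ∣x-y∣≈z {x} {y} {z} 0≤z x≈y+z = antisym
    (∣x-y∣≤z (reflexive x≈y+z)
      (≤-trans (x≤x+y 0≤z) (≤-trans (reflexive (Eq.sym x≈y+z)) (x≤x+y 0≤z))))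
    (≤-trans (reflexive (Eq.sym (Eq.trans (+-congʳ x≈y+z) (xyx⁻¹≈y y z)))) (x≤x⊔y _ _))

  ∣x-x∣≤0 : ∀ x → ∣ x - x ∣ ≤ 0#
  ∣x-x∣≤0 x = reflexive (∣x-y∣≈z ≤-refl (Eq.sym (+-identityʳ x)))

  ∣-∣-cong : ∀ {x x′ y y′} → x ≈ x′ → y ≈ y′ → ∣ x - y ∣ ≈ ∣ x′ - y′ ∣
  ∣-∣-cong x≈x′ y≈y′ = ⊔-cong x-y≈x′-y′ (-‿cong x-y≈x′-y′)
    where x-y≈x′-y′ = +-cong x≈x′ (-‿cong y≈y′)

  0≤x*x : ∀ x → 0# ≤ x * x
  0≤x*x x with total 0# x
  ... | inj₁ 0≤x = *-nonNegative 0≤x 0≤x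
  ... | inj₂ x≤0 = ≤-trans (*-nonNegative 0≤-x 0≤-x) (reflexive
          (Eq.trans (Eq.sym (-‿distribˡ-* x (- x)))
          (Eq.trans (-‿cong (Eq.sym (-‿distribʳ-* x x))) (⁻¹-involutive (x * x)))))
    where
    0≤-x : 0# ≤ - x
    0≤-x = ≤-trans (x≤y⇒0≤y-x x≤0) (reflexive (+-identityˡ _))

  0≤1 : 0# ≤ 1#
  0≤1 = ≤-trans (0≤x*x 1#) (reflexive (*-identityˡ 1#))

  half : ∃[ h ] 0# ≤ h × h + h ≈ 1#
  half =
    let h , 2h≈1 = inverse 2# 2≉0
        h*2≈1 = Eq.trans (*-comm h 2#) 2h≈1
    in h
     -- The inverse of 2 comes without a sign; it is nonnegative because h = (h * h) * 2.
     , ≤-trans (*-nonNegative (0≤x*x h) 0≤2)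
         (reflexive (Eq.trans (*-assoc h h 2#) (Eq.trans (*-congˡ h*2≈1) (*-identityʳ h))))
     , Eq.trans (Eq.sym (Eq.trans (distribˡ h 1# 1#) (+-cong (*-identityʳ h) (*-identityʳ h)))) h*2≈1
    where
    2# = 1# + 1#
    0≤2 : 0# ≤ 2#
    0≤2 = ≤-trans 0≤1 (x≤x+y 0≤1)
    2≉0 : ¬ (2# ≈ 0#)
    2≉0 2≈0 = 0≉1 (antisym 0≤1 (≤-trans (x≤x+y 0≤1) (reflexive 2≈0)))

  -- Otherwise half of x - y is a positive ε, and the hypothesis for it gives ε + ε ≤ ε, hence ε ≤
  -- 0.
  x≤y+ε⇒x≤y : ∀ {x y} → (∀ ε → 0# < ε → x ≤ y + ε) → x ≤ y
  x≤y+ε⇒x≤y {x} {y} x≤y+ε with em {x ≤ y}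
  ... | yes x≤y = x≤y
  ... | no x≰y  = contradiction x≤y x≰y
    where
    h = proj₁ half
    ε = (x - y) * h
    ε+ε≈x-y : ε + ε ≈ x - y
    ε+ε≈x-y = Eq.trans (Eq.sym (distribˡ _ h h))
      (Eq.trans (*-congˡ (proj₂ (proj₂ half))) (*-identityʳ _))
    ε≰0 : ¬ (ε ≤ 0#)
    ε≰0 ε≤0 = x≰y (≤-trans
      (x-y≤z⇒x≤y+z (≤-trans (reflexive (Eq.sym ε+ε≈x-y))
        (≤-trans (+-monoʳ-≤ ε ε≤0) (≤-trans (reflexive (+-identityʳ ε)) ε≤0))))
      (reflexive (+-identityʳ y)))
    x≤y : x ≤ y
    x≤y = contradiction
      (≤-trans (reflexive (Eq.sym (xyx⁻¹≈y ε ε)))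
        (≤-trans (+-monoˡ-≤ (- ε)
          (≤-trans (reflexive ε+ε≈x-y) (x≤y+z⇒x-y≤z (x≤y+ε ε (≰⇒> ε≰0)))))
          (reflexive (-‿inverseʳ ε))))
      ε≰0

  -- Order, suprema and infima in [0,∞]

  ≤∞-refl : ∀ {v} → v ≤∞ v
  ≤∞-refl = TotalOrder.refl ℝ∞-totalOrder

  ≤∞-trans : ∀ {u v w} → u ≤∞ v → v ≤∞ w → u ≤∞ w
  ≤∞-trans = TotalOrder.trans ℝ∞-totalOrder

  ≤∞-reflexive : ∀ {u v} → u ≈∞ v → u ≤∞ v
  ≤∞-reflexive = TotalOrder.reflexive ℝ∞-totalOrder

  ≈∞-sym : ∀ {u v} → u ≈∞ v → v ≈∞ u
  ≈∞-sym = TotalOrder.Eq.sym ℝ∞-totalOrder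

  [≤]⁻¹ : ∀ {x y} → [ x ] ≤∞ [ y ] → proj₁ x ≤ proj₁ y
  [≤]⁻¹ = SupNonStrict.[≤]-injective _≤₊_

  -- Only finite bounds w of u need an ε of room. An infinite u bounds everything, and for finite u
  -- an infinite v is refuted at w = u, ε = 1.
  ≤∞-approx : ∀ {u v} →
    (∀ w ε (0<ε : 0# < ε) → u ≤∞ [ w ] → v ≤∞ [ w +₊ (ε , proj₁ 0<ε) ]) → v ≤∞ u
  ≤∞-approx {⊤⁺}          _  = _ ≤⊤⁺
  ≤∞-approx {[ w ]} {⊤⁺}  v≤ with () ← v≤ w 1# (0≤1 , 0≉1) ≤∞-refl
  ≤∞-approx {[ w ]} {[ _ ]} v≤ = [ x≤y+ε⇒x≤y (λ ε 0<ε → [≤]⁻¹ (v≤ w ε 0<ε ≤∞-refl)) ]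

  module _ {X : Set} (F : X → ℝ∞) where

    ≤-⨆ : ∀ x → F x ≤∞ ⨆ F
    ≤-⨆ = proj₁ (proj₂ (sup∞-exists F))

    ⨆-≤ : ∀ {u} → (∀ x → F x ≤∞ u) → ⨆ F ≤∞ u
    ⨆-≤ = proj₂ (proj₂ (sup∞-exists F)) _

    ⨅-≤ : ∀ x → ⨅ F ≤∞ F x
    ⨅-≤ = proj₁ (proj₂ (inf∞-exists F))

    ≤-⨅ : ∀ {u} → (∀ x → u ≤∞ F x) → u ≤∞ ⨅ F
    ≤-⨅ = proj₂ (proj₂ (inf∞-exists F)) _

  -- Allows negative reals on the left, which ℝ∞ does not contain.
  infix 4 _≼_
  data _≼_ (x : ℝ) : ℝ∞ → Set where
    fin : ∀ {w} → x ≤ proj₁ w → x ≼ [ w ]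
    top : x ≼ ⊤⁺

  fin⁻¹ : ∀ {x w} → x ≼ [ w ] → x ≤ proj₁ w
  fin⁻¹ (fin x≤w) = x≤w

  ≼⇒≤∞ : ∀ {x v} → proj₁ x ≼ v → [ x ] ≤∞ v
  ≼⇒≤∞ (fin x≤w) = [ x≤w ]
  ≼⇒≤∞ top       = _ ≤⊤⁺

  ≤-≼-trans : ∀ {x y v} → x ≤ y → y ≼ v → x ≼ v
  ≤-≼-trans x≤y (fin y≤w) = fin (≤-trans x≤y y≤w)
  ≤-≼-trans x≤y top       = top

  ≼-≤∞-trans : ∀ {x u v} → x ≼ u → u ≤∞ v → x ≼ v
  ≼-≤∞-trans (fin x≤w) [ w≤w′ ]  = fin (≤-trans x≤w w≤w′)
  ≼-≤∞-trans _         (_ ≤⊤⁺)   = top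

  ≤∞⇒≼ : ∀ {x v} → [ x ] ≤∞ v → proj₁ x ≼ v
  ≤∞⇒≼ = ≼-≤∞-trans (fin ≤-refl)

  ≤0⇒≼ : ∀ {x v} → x ≤ 0# → x ≼ v
  ≤0⇒≼ {v = ⊤⁺}    x≤0 = top
  ≤0⇒≼ {v = [ w ]} x≤0 = fin (≤-trans x≤0 (proj₂ w))

  ≼-⨅ : ∀ {X : Set} {F : X → ℝ∞} {x} → (∀ i → x ≼ F i) → x ≼ ⨅ F
  ≼-⨅ {F = F} {x} x≼F with total 0# x
  ... | inj₁ 0≤x = ≤∞⇒≼ {x , 0≤x} (≤-⨅ F λ i → ≼⇒≤∞ (x≼F i))
  ... | inj₂ x≤0 = ≤0⇒≼ x≤0

  ⊔-≼ : ∀ {x y v} → x ≼ v → y ≼ v → x ⊔ y ≼ v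
  ⊔-≼ {x} {y} x≼v y≼v with ⊔-sel x y
  ... | inj₁ ≈x = ≤-≼-trans (reflexive ≈x) x≼v
  ... | inj₂ ≈y = ≤-≼-trans (reflexive ≈y) y≼v

  foldr-⊔-≼ : ∀ {k v} (F : Fin k → ℝ) → (∀ i → F i ≼ v) → foldr _⊔_ 0# F ≼ v
  foldr-⊔-≼ {zero}  F F≼v = ≤0⇒≼ ≤-refl
  foldr-⊔-≼ {suc k} F F≼v = ⊔-≼ (F≼v zero) (foldr-⊔-≼ (F ∘ suc) (F≼v ∘ suc))

  -- Replaces v by a real w, so that estimates against v can use subtraction: a finite v is itself
  -- such a w, and an infinite v has nothing to prove.
  ≼-intro : ∀ {x v} → (∀ w → (∀ {t} → t ≼ v → t ≤ w) → x ≤ w) → x ≼ v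
  ≼-intro {v = ⊤⁺}    _   = top
  ≼-intro {v = [ w ]} x≤w = fin (x≤w (proj₁ w) fin⁻¹)

  -- Quantifying over all lower bounds t of the distances from F x to the values
  -- of G avoids an approximate minimiser, and with it every ε.
  module _ {X Y : Set} {F : X → ℝ} {G : Y → ℝ} {v : ℝ∞}
    (forth : ∀ x t → (∀ y → t ≤ ∣ F x - G y ∣) → t ≼ v)
    (back  : ∀ y t → (∀ x → t ≤ ∣ F x - G y ∣) → t ≼ v)
    where

    sup-gap : ∀ {p q} → IsSup _≤_ F p → IsSup _≤_ G q → ∣ p - q ∣ ≼ v
    sup-gap {p} {q} (F≤p , p-least) (G≤q , q-least) = ≼-intro λ w ≼v⇒≤w → ∣x-y∣≤z
      (p-least _ λ x → x-y≤z⇒x≤y+z (≼v⇒≤w (forth x (F x - q) λ y →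
        x≤y+z⇒x-y≤z (≤-trans (x≤y+∣x-y∣ _ _) (+-monoˡ-≤ _ (G≤q y))))))
      (q-least _ λ y → x-y≤z⇒x≤y+z (≼v⇒≤w (back y (G y - p) λ x →
        x≤y+z⇒x-y≤z (≤-trans (y≤x+∣x-y∣ _ _) (+-monoˡ-≤ _ (F≤p x))))))

    inf-gap : ∀ {p q} → IsInf _≤_ F p → IsInf _≤_ G q → ∣ p - q ∣ ≼ v
    inf-gap {p} {q} (p≤F , p-greatest) (q≤G , q-greatest) = ≼-intro λ w ≼v⇒≤w → ∣x-y∣≤z
      (x-y≤z⇒x≤z+y (q-greatest _ λ y → x≤y+z⇒x-z≤y (x-y≤z⇒x≤y+z
        (≼v⇒≤w (back y (p - G y) λ x → x≤y+z⇒x-y≤z (≤-trans (p≤F x) (x≤y+∣x-y∣ _ _)))))))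
      (x-y≤z⇒x≤z+y (p-greatest _ λ x → x≤y+z⇒x-z≤y (x-y≤z⇒x≤y+z
        (≼v⇒≤w (forth x (q - F x) λ y → x≤y+z⇒x-y≤z (≤-trans (q≤G y) (y≤x+∣x-y∣ _ _)))))))
      where
      x-y≤z⇒x≤z+y : ∀ {x y z} → x - y ≤ z → x ≤ z + y
      x-y≤z⇒x≤z+y x-y≤z = ≤-trans (x-y≤z⇒x≤y+z x-y≤z) (reflexive (+-comm _ _))
      x≤y+z⇒x-z≤y : ∀ {x y z} → x ≤ y + z → x - z ≤ y
      x≤y+z⇒x-z≤y x≤y+z = x≤y+z⇒x-y≤z (≤-trans x≤y+z (reflexive (+-comm _ _)))

-- Extended tuples, and continuity on a setoid

module Interpretations (em : ExcludedMiddle 0ℓ) (R : CompleteOrderedField) where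

  open MetricLogic em R
  open Classical em
  open Reals em R
  open Structure using (Carrier; d)

  ∷ʳ-inject₁ : ∀ {X : Set} {n} (a : Fin n → X) c i → (a ∷ʳ c) (inject₁ i) ≡ a i
  ∷ʳ-inject₁ a c zero    = refl
  ∷ʳ-inject₁ a c (suc i) = ∷ʳ-inject₁ (a ∘ suc) c i

  ∷ʳ-pointwise : ∀ {X Y : Set} {n} (P : ℕ → X → Y → Set) {a : Fin n → X} {b : Fin n → Y} {c e} →
                 (∀ i → P (toℕ i) (a i) (b i)) → P n c e →
                 ∀ i → P (toℕ i) ((a ∷ʳ c) i) ((b ∷ʳ e) i)
  ∷ʳ-pointwise {n = zero}  P Pab Pce zero    = Pce
  ∷ʳ-pointwise {n = suc n} P Pab Pce zero    = Pab zero
  ∷ʳ-pointwise {n = suc n} P Pab Pce (suc i) = ∷ʳ-pointwise (P ∘ suc) (Pab ∘ suc) Pce i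

  ≈⇒∣-∣< : ∀ {x y ε} → x ≈ y → 0# < ε → ∣ x - y ∣ < ε
  ≈⇒∣-∣< x≈y 0<ε = ≰⇒> λ ε≤∣x-y∣ →
    <⇒≱ 0<ε (≤-trans ε≤∣x-y∣ (≤-trans (reflexive (∣-∣-cong x≈y Eq.refl)) (∣x-x∣≤0 _)))

  -- Equivalent arguments are closer than every δ, so the values are closer than every ε.
  continuous-cong : ∀ {m} {S : Fin m → ℝ → Set} {f : (∀ i → ∃ (S i)) → ℝ} → Continuous S f →
                    ∀ x y → (∀ i → proj₁ (x i) ≈ proj₁ (y i)) → f x ≈ f y
  continuous-cong {f = f} f-cont x y x≈y = antisym
    (f≤f x y x≈y) (f≤f y x (λ i → Eq.sym (x≈y i)))
    where
    f≤f : ∀ x y → (∀ i → proj₁ (x i) ≈ proj₁ (y i)) → f x ≤ f y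
    f≤f x y x≈y = x≤y+ε⇒x≤y λ ε 0<ε →
      let δ , 0<δ , near = f-cont x ε 0<ε
      in ≤-trans (x≤y+∣x-y∣ _ _) (+-monoʳ-≤ _ (proj₁ (near y λ i → ≈⇒∣-∣< (x≈y i) 0<δ)))

  -- Monotonicity and smallness of moduli

  excess : (x y : ℝ≥0) → x ≤₊ y → ∃[ z ] x +₊ z ≈₊ y
  excess x y x≤y = (proj₁ y - proj₁ x , x≤y⇒0≤y-x x≤y) , x+[y-x]≈y _ _

  modulus-mono : ∀ {n} (M : Modulus n) {δ η : Fin n → ℝ≥0} → (∀ i → δ i ≤₊ η i) →
                 Modulus.Δ M δ ≤₊ Modulus.Δ M η
  modulus-mono M {δ} {η} δ≤η = ≤-trans
    (Modulus.monotone M δ (λ i → proj₁ (excess (δ i) (η i) (δ≤η i))))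
    (reflexive (continuous-cong (Modulus.continuous M) _ _
      λ i → proj₂ (excess (δ i) (η i) (δ≤η i))))

  module _ (Ω : WeakModulus) where

    open WeakModulus Ω renaming (Ω to Δ)

    -- Respect for _≈₊_ is not part of WeakModulus; it comes from lower
    -- semicontinuity.
    weakModulus-cong-≤ : ∀ {δ η} → (∀ i → δ i ≈₊ η i) → Δ δ ≤∞ Δ η
    weakModulus-cong-≤ {δ} {η} δ≈η with Δ δ in Δδ≡ | Δ η in Δη≡
    ... | u   | ⊤⁺    = u ≤⊤⁺
    ... | u | [ s ] with em {u ≤∞ [ s ]}
    ...   | yes u≤s = u≤s
    ...   | no u≰s  =
      let N , ε , 0<ε , near = lowerSemicontinuous δ s (subst ([ s ] <∞_) (sym Δδ≡) (above u≰s))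
      in contradiction (subst ([ s ] <∞_) Δη≡ (near η λ i _ → ≈⇒∣-∣< (δ≈η i) 0<ε)) λ
           { (SupStrict.[ s<s ]) → <⇒≱ s<s ≤-refl }
      where
      above : ∀ {u} → ¬ (u ≤∞ [ s ]) → [ s ] <∞ u
      above {⊤⁺}    _   = SupStrict.[ s ]<⊤⁺
      above {[ x ]} x≰s = SupStrict.[ ≰⇒> (λ x≤s → x≰s [ x≤s ]) ]

    weakModulus-mono : ∀ {δ η} → (∀ i → δ i ≤₊ η i) → Δ δ ≤∞ Δ η
    weakModulus-mono {δ} {η} δ≤η = ≤∞-trans
      (monotone δ (λ i → proj₁ (excess (δ i) (η i) (δ≤η i))))
      (weakModulus-cong-≤ λ i → proj₂ (excess (δ i) (η i) (δ≤η i)))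

    -- Continuity in argument n at the origin, where Ω vanishes. As η depends on n and ε only, all
    -- Ω-formulas share it as a modulus in their last variable.
    weakModulus-small : ∀ n ε → 0# < ε → ∃[ η ] 0# < η × (∀ t → proj₁ t < η →
                        ∀ {x} → x ≼ Δ ((λ _ → 0₊) [ n ≔ t ]) → x ≤ ε)
    weakModulus-small n ε 0<ε =
      let η , 0<η , near = proj₂ (separatelyContinuous (λ _ → 0₊) n 0₊ (ε , proj₁ 0<ε)) Δ0<ε
      in η , 0<η , λ t t<η x≼ → bounded x≼ (near t (∣0-t∣< t t<η))
      where
      0[n≔0]≈0 : ∀ i → ((λ _ → 0₊) [ n ≔ 0₊ ]) i ≈₊ 0₊
      0[n≔0]≈0 i with i ≟ n
      ... | yes _ = Eq.refl
      ... | no  _ = Eq.refl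
      ≤0⇒<ε : ∀ {u} → u ≤∞ [ 0₊ ] → u <∞ [ ε , proj₁ 0<ε ]
      ≤0⇒<ε [ u≤0 ] = SupStrict.[ ≰⇒> (λ ε≤u → <⇒≱ 0<ε (≤-trans ε≤u u≤0)) ]
      Δ0<ε : Δ ((λ _ → 0₊) [ n ≔ 0₊ ]) <∞ [ ε , proj₁ 0<ε ]
      Δ0<ε = ≤0⇒<ε (≤∞-trans (weakModulus-cong-≤ 0[n≔0]≈0) (≤∞-reflexive vanishes))
      ∣0-t∣< : ∀ {η} t → proj₁ t < η → ∣ 0# - proj₁ t ∣ < η
      ∣0-t∣< t t<η = ≰⇒> λ η≤ → <⇒≱ t<η (≤-trans η≤ (∣x-y∣≤z
        (≤-trans (proj₂ t) (x≤x+y (proj₂ t)))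
        (reflexive (Eq.sym (+-identityˡ _)))))
      bounded : ∀ {x u} → x ≼ u → u <∞ [ ε , proj₁ 0<ε ] → x ≤ ε
      bounded (fin x≤w) SupStrict.[ w<ε ] = ≤-trans x≤w (proj₁ w<ε)

  extend-≤ : ∀ {n} {δ : Fin n → ℝ≥0} {η : ℕ → ℝ≥0} → (∀ i → δ i ≤₊ η (toℕ i)) →
             ∀ k → extend δ k ≤₊ η k
  extend-≤ {n} {η = η} δ≤η k with k <? n
  ... | yes k<n = ≤-trans (δ≤η _) (reflexive (Eq.reflexive (cong (proj₁ ∘ η) (toℕ-fromℕ< k<n))))
  ... | no  _   = proj₂ (η k)

  extend-≤∞ : ∀ Ω {n} (δ : Fin n → ℝ≥0) (η : ℕ → ℝ≥0) → (∀ i → δ i ≤₊ η (toℕ i)) →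
              (Ω ∣ n) δ ≤∞ WeakModulus.Ω Ω η
  extend-≤∞ Ω δ η δ≤η = weakModulus-mono Ω (extend-≤ {δ = δ} {η} δ≤η)

  extend-toℕ : ∀ {n} (δ : Fin n → ℝ≥0) i → extend δ (toℕ i) ≡ δ i
  extend-toℕ {n} δ i with toℕ i <? n
  ... | yes i<n = cong δ (fromℕ<-toℕ i i<n)
  ... | no  i≮n = contradiction (toℕ<n i) i≮n

  -- Terms and basic formulas respect their moduli

  module _ {L : Signature} where

    open Signature L

    d-refl : ∀ (A : Structure L) x → proj₁ (d A x x) ≤ 0#
    d-refl A x = reflexive (≈⇒0 EqC.refl)
      where open IsGeneralMetric (Structure.isMetric A) using (≈⇒0; module EqC)

    module _ (A : Structure L) {n} {a a′ : Fin n → Carrier A} {δ : Fin n → ℝ≥0}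
      (a~a′ : ∀ i → d A (a i) (a′ i) ≤₊ δ i) where

      open Structure A using (fun-respects; pred-respects)

      term-respects : ∀ τ → d A (⟦ A ⟧ₜ τ a) (⟦ A ⟧ₜ τ a′) ≤₊ termModulus τ δ
      term-respects (var i)    = a~a′ i
      term-respects (app F ts) = ≤-trans (fun-respects F _ _)
        (modulus-mono (funModulus F) λ i → term-respects (ts i))

      atom-respects : ∀ φ → ∣ proj₁ (⟦ A ⟧ₐ φ a) - proj₁ (⟦ A ⟧ₐ φ a′) ∣₊ ≤₊ atomicModulus φ δ
      atom-respects φ = ≤-trans (pred-respects symbol _ _)
        (modulus-mono (predModulus symbol) λ i → term-respects (args i))
        where open Atomic φ

      basic-respects : ∀ φ → ∣ ⟦ A ⟧ᵇ φ a - ⟦ A ⟧ᵇ φ a′ ∣ ≼ basicModulus φ δ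
      basic-respects φ = ≤∞⇒≼ (≤-⨆ _ (_ , _ , λ i → atom-respects (Basic.atoms φ i)))

    -- Adding a dummy last variable

    weakenₜ : ∀ {n} → Term L n → Term L (suc n)
    weakenₜ (var i)    = var (inject₁ i)
    weakenₜ (app F ts) = app F λ i → weakenₜ (ts i)

    weakenₐ : ∀ {n} → Atomic L n → Atomic L (suc n)
    weakenₐ φ = record { symbol = symbol ; args = λ i → weakenₜ (args i) }
      where open Atomic φ

    weaken : ∀ {n} → Basic L n → Basic L (suc n)
    weaken φ = record { atoms = λ i → weakenₐ (atoms i) ; f = f ; continuous = continuous }
      where open Basic φ

    module _ (A : Structure L) {n} (a : Fin n → Carrier A) (c : Carrier A) where

      open Structure A using (fun-respects; pred-respects)

      -- Distance zero takes the place of equality, since argument tuples agree only pointwise; it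
      -- passes through function symbols because their moduli vanish at 0.
      weakenₜ-sound : ∀ τ → d A (⟦ A ⟧ₜ (weakenₜ τ) (a ∷ʳ c)) (⟦ A ⟧ₜ τ a) ≤₊ 0₊
      weakenₜ-sound (var i)    =
        subst (λ x → d A x (a i) ≤₊ 0₊) (sym (∷ʳ-inject₁ a c i)) (d-refl A (a i))
      weakenₜ-sound (app F ts) = ≤-trans (fun-respects F _ _) (≤-trans
        (modulus-mono (funModulus F) λ i → weakenₜ-sound (ts i))
        (reflexive (Modulus.vanishes (funModulus F))))

      weakenₐ-sound : ∀ φ → proj₁ (⟦ A ⟧ₐ (weakenₐ φ) (a ∷ʳ c)) ≈ proj₁ (⟦ A ⟧ₐ φ a)
      weakenₐ-sound φ = ∣x-y∣≤0⇒x≈y (≤-trans (pred-respects symbol _ _) (≤-trans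
        (modulus-mono (predModulus symbol) λ i → weakenₜ-sound (args i))
        (reflexive (Modulus.vanishes (predModulus symbol)))))
        where open Atomic φ

      weaken-sound : ∀ φ → ⟦ A ⟧ᵇ (weaken φ) (a ∷ʳ c) ≈ ⟦ A ⟧ᵇ φ a
      weaken-sound φ = continuous-cong continuous _ _ λ i → weakenₐ-sound (atoms i)
        where open Basic φ

    module _ {n} (δ : Fin (suc n) → ℝ≥0) where

      weakenₜ-modulus : ∀ τ → termModulus (weakenₜ τ) δ ≤₊ termModulus τ (δ ∘ inject₁)
      weakenₜ-modulus (var i)    = ≤-refl
      weakenₜ-modulus (app F ts) = modulus-mono (funModulus F) λ i → weakenₜ-modulus (ts i)

      weakenₐ-modulus : ∀ φ → atomicModulus (weakenₐ φ) δ ≤₊ atomicModulus φ (δ ∘ inject₁)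
      weakenₐ-modulus φ = modulus-mono (predModulus symbol) λ i → weakenₜ-modulus (args i)
        where open Atomic φ

      weaken-modulus : ∀ φ → basicModulus (weaken φ) δ ≤∞ basicModulus φ (δ ∘ inject₁)
      weaken-modulus φ = ⨆-≤ _ λ (x , y , x~y) →
        ≤-⨆ _ (x , y , λ i → ≤-trans (x~y i) (weakenₐ-modulus (Basic.atoms φ i)))

    -- Dropping the last entry of δ puts 0 in its place in the extended sequence, which can only
    -- lower Ω.
    weaken-respects : ∀ Ω {n} (φ : Basic L n) → RespectsModulus Ω φ → RespectsModulus Ω (weaken φ)
    weaken-respects Ω φ φ-respects δ = ≤∞-trans (weaken-modulus δ φ) (≤∞-trans
      (φ-respects (δ ∘ inject₁))
      (extend-≤∞ Ω (δ ∘ inject₁) (extend δ) λ i → reflexive (Eq.reflexive (cong proj₁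
        (sym (trans (cong (extend δ) (sym (toℕ-inject₁ i))) (extend-toℕ δ (inject₁ i))))))))

    -- Gaps between the values of a formula in two structures

    module _ {Ω : WeakModulus} (A B : Structure L) where

      gap : ∀ {n I} → Formula L Ω n I → (Fin n → Carrier A) → (Fin n → Carrier B) → ℝ
      gap φ a b = ∣ proj₁ (⟦ A ⟧ φ a) - proj₁ (⟦ B ⟧ φ b) ∣

      -- The hypotheses are the two kinds of move: an element of one structure against all elements
      -- of the other. They suffice with t the excess of a value over the other side's supremum, or
      -- of the other side's infimum over a value.
      quantifier-gap : ∀ {n I} (φ : Formula L Ω (suc n) I) {a b v} →
        (∀ c t → (∀ e → t ≤ gap φ (a ∷ʳ c) (b ∷ʳ e)) → t ≼ v) →
        (∀ e t → (∀ c → t ≤ gap φ (a ∷ʳ c) (b ∷ʳ e)) → t ≼ v) →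
        gap (inf′ φ) a b ≼ v × gap (sup′ φ) a b ≼ v
      quantifier-gap φ forth back =
          inf-gap forth back (proj₂ (inf-exists _ _ _)) (proj₂ (inf-exists _ _ _))
        , sup-gap forth back (proj₂ (complete _ _ _)) (proj₂ (complete _ _ _))

      module _ {n} {a : Fin n → Carrier A} {b : Fin n → Carrier B} {v : ℝ∞} {α : Ord}
        (basic-gap : ∀ φ → RespectsModulus Ω φ → ∃[ I ] RespectsBound I φ →
                     ∣ ⟦ A ⟧ᵇ φ a - ⟦ B ⟧ᵇ φ b ∣ ≼ v)
        (quantified-gap : ∀ {I} (φ : Formula L Ω (suc n) I) → qr φ <ₒ α →
                          gap (inf′ φ) a b ≼ v × gap (sup′ φ) a b ≼ v)
        where

        -- Connectives keep the arity and never widen the gap. Quantifiers change the arity and are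
        -- left as a hypothesis, so one induction serves uniform continuity and all three kinds of
        -- level.
        formula-gap : ∀ {I} (φ : Formula L Ω n I) → qr φ ≤ₒ α → gap φ a b ≼ v
        formula-gap {I} (basic φ φ-resp φ∈I) _ = basic-gap φ φ-resp (I , φ∈I)
        formula-gap (⋁ φ) q = sup-gap
          (λ i t t≤ → ≤-≼-trans (t≤ i) (formula-gap (φ i) (sup-≤⁻¹ q i)))
          (λ i t t≤ → ≤-≼-trans (t≤ i) (formula-gap (φ i) (sup-≤⁻¹ q i)))
          (proj₂ (complete _ _ _)) (proj₂ (complete _ _ _))
        formula-gap (⋀ φ) q = inf-gap
          (λ i t t≤ → ≤-≼-trans (t≤ i) (formula-gap (φ i) (sup-≤⁻¹ q i)))
          (λ i t t≤ → ≤-≼-trans (t≤ i) (formula-gap (φ i) (sup-≤⁻¹ q i)))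
          (proj₂ (inf-exists _ _ _)) (proj₂ (inf-exists _ _ _))
        formula-gap (inf′ φ) q = proj₁ (quantified-gap φ q)
        formula-gap (sup′ φ) q = proj₂ (quantified-gap φ q)
        formula-gap (lipschitz f f-lip _ φs) q = ≤-≼-trans (f-lip _ _)
          (foldr-⊔-≼ _ λ i → formula-gap (φs i) (foldr-⊔ₒ-≤⁻¹ (qr ∘ φs) q i))

    -- Under a quantifier each c is answered by c itself, at distance 0. Hence the same infinite
    -- sequence δ works however far the tuples grow. The recursion is on rank, because `formula-gap`
    -- takes the quantifier case as an argument.
    formula-respects : ∀ {Ω} (A : Structure L) (δ : ℕ → ℝ≥0) {n} {a a′ : Fin n → Carrier A} →
      (∀ i → d A (a i) (a′ i) ≤₊ δ (toℕ i)) → ∀ {I} (φ : Formula L Ω n I) →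
      gap A A φ a a′ ≼ WeakModulus.Ω Ω δ
    formula-respects {Ω} A δ a~a′ φ = go (<ₒ-wellFounded (qr φ)) a~a′ φ ≤ₒ-refl
      where
      go : ∀ {α} → Acc _<ₒ_ α → ∀ {n} {a a′ : Fin n → Carrier A} →
           (∀ i → d A (a i) (a′ i) ≤₊ δ (toℕ i)) →
           ∀ {I} (φ : Formula L Ω n I) → qr φ ≤ₒ α → gap A A φ a a′ ≼ WeakModulus.Ω Ω δ
      go {α} (acc below) {n} {a} {a′} a~a′ = formula-gap A A
        (λ φ φ-resp _ → ≼-≤∞-trans (basic-respects A a~a′ φ)
          (≤∞-trans (φ-resp (δ ∘ toℕ)) (extend-≤∞ Ω {n} (δ ∘ toℕ) δ λ _ → ≤-refl)))
        (λ φ q → quantifier-gap A A φ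
          (λ c t t≤ → ≤-≼-trans (t≤ c) (diagonal φ q c))
          (λ c t t≤ → ≤-≼-trans (t≤ c) (diagonal φ q c)))
        where
        diagonal : ∀ {I} (φ : Formula L Ω (suc n) I) → qr φ <ₒ α →
                   ∀ c → gap A A φ (a ∷ʳ c) (a′ ∷ʳ c) ≼ WeakModulus.Ω Ω δ
        diagonal φ q c = go (below q)
          (∷ʳ-pointwise (λ k x y → d A x y ≤₊ δ k) a~a′
            (≤-trans (d-refl A c) (proj₂ (δ _))))
          φ ≤ₒ-refl

    -- The image is all of [0,t] for every suitable v and I: only formulas with one
    -- and the same bound can be joined by ⋁.
    module Truncation (t : ℝ) (0≤t : 0# ≤ t) (v : ℝ) where

      range : Interval
      range = record { lo = 0# ; hi = t ; lo≤hi = 0≤t }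

      truncate : (Fin 1 → ℝ) → ℝ
      truncate x = t ⊓ ∣ x zero - v ∣

      truncate-1-lipschitz : OneLipschitz truncate
      truncate-1-lipschitz x y = ≤-trans
        (∣x-y∣≤z (one-sided (x zero) (y zero))
          (≤-trans (one-sided (y zero) (x zero)) (+-monoʳ-≤ _ (∣x-y∣≤∣y-x∣ _ _))))
        (x≤x⊔y _ _)
        where
        one-sided : ∀ x y → t ⊓ ∣ x - v ∣ ≤ t ⊓ ∣ y - v ∣ + ∣ x - y ∣
        one-sided x y with ⊓-sel t ∣ y - v ∣
        ... | inj₁ ≈t = ≤-trans (x⊓y≤x _ _)
          (≤-trans (x≤x+y 0≤∣ x - y ∣) (+-monoˡ-≤ _ (reflexive (Eq.sym ≈t))))
        ... | inj₂ ≈∣y-v∣ = ≤-trans (x⊓y≤y _ _)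
          (≤-trans (triangle x y v) (+-monoˡ-≤ _ (reflexive (Eq.sym ≈∣y-v∣))))

      truncate-image : ∀ {I z} → v ∈ I → z ∈ I → t ≤ ∣ v - z ∣ → IsImage truncate I range
      truncate-image {I} {z} (lo≤v , v≤hi) (lo≤z , z≤hi) t≤∣v-z∣ y = mk⇔ preimage
        (λ (x , _ , y≈) →
            ≤-trans (⊓-glb 0≤t 0≤∣ _ ∣) (reflexive (Eq.sym y≈))
          , ≤-trans (reflexive y≈) (x⊓y≤x _ _))
        where
        preimage : y ∈ range → ∃[ x ] (∀ i → x i ∈ I) × y ≈ truncate x
        preimage (0≤y , y≤t) with total v z
        -- As z is at distance at least t ≥ y from v, moving by y from v towards z stays between
        -- them, hence inside I.
        ... | inj₁ v≤z = (λ _ → v + y)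
          , (λ _ → ≤-trans lo≤v (x≤x+y 0≤y) , ≤-trans (+-monoʳ-≤ v y≤t) (≤-trans v+t≤z z≤hi))
          , antisym (⊓-glb y≤t (reflexive (Eq.sym ∣x-v∣≈y)))
                    (≤-trans (x⊓y≤y _ _) (reflexive ∣x-v∣≈y))
          where
          ∣x-v∣≈y : ∣ v + y - v ∣ ≈ y
          ∣x-v∣≈y = ∣x-y∣≈z 0≤y Eq.refl
          v+t≤z : v + t ≤ z
          v+t≤z = ≤-trans (+-monoʳ-≤ v (≤-trans t≤∣v-z∣ (≤-trans (∣x-y∣≤∣y-x∣ v z)
            (reflexive (∣x-y∣≈z (x≤y⇒0≤y-x v≤z) (Eq.sym (x+[y-x]≈y v z))))))) (reflexive (x+[y-x]≈y v z))
        ... | inj₂ z≤v = (λ _ → v - y)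
          , (λ _ → ≤-trans lo≤z z≤v-y , ≤-trans (x≤y+z⇒x-y≤z v≤y+v) v≤hi)
          , antisym (⊓-glb y≤t (reflexive (Eq.sym ∣x-v∣≈y)))
                    (≤-trans (x⊓y≤y _ _) (reflexive ∣x-v∣≈y))
          where
          v≤y+v : v ≤ y + v
          v≤y+v = ≤-trans (x≤x+y 0≤y) (reflexive (+-comm v y))
          v-y+y≈v : v ≈ v - y + y
          v-y+y≈v = Eq.sym (Eq.trans (+-comm (v - y) y) (x+[y-x]≈y y v))
          ∣x-v∣≈y : ∣ v - y - v ∣ ≈ y
          ∣x-v∣≈y = Eq.trans (antisym (∣x-y∣≤∣y-x∣ _ _) (∣x-y∣≤∣y-x∣ _ _)) (∣x-y∣≈z 0≤y v-y+y≈v)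
          t≤v-z : t ≤ v - z
          t≤v-z = ≤-trans t≤∣v-z∣ (reflexive (∣x-y∣≈z (x≤y⇒0≤y-x z≤v) (Eq.sym (x+[y-x]≈y z v))))
          z≤v-y : z ≤ v - y
          z≤v-y = ≤-trans (reflexive (Eq.sym (x+y-y≈x z y))) (+-monoˡ-≤ (- y)
            (≤-trans (+-monoʳ-≤ z (≤-trans y≤t t≤v-z)) (reflexive (x+[y-x]≈y z v))))

    -- A separating formula of the next rank from a dense sequence

    module _ {Ω : WeakModulus} (A B : Structure L) (separable : Separable B) where

      distinguish : ∀ {n} {a : Fin n → Carrier A} {b : Fin n → Carrier B} (c : Carrier A) {t} →
        0# ≤ t → ∀ {β} →
        (∀ e → Σ[ I ∈ Interval ] Σ[ φ ∈ Formula L Ω (suc n) I ]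
               qr φ ≤ₒ β × t ≤ gap A B φ (a ∷ʳ c) (b ∷ʳ e)) →
        Σ[ I ∈ Interval ] Σ[ ψ ∈ Formula L Ω n I ] qr ψ ≤ₒ suc β × t ≤ gap A B ψ a b
      distinguish {n} {a} {b} c {t} 0≤t {β} separated =
        T , inf′ (⋁ χ) , s≤s (sup-≤ χ-rank) ,
        ≤-trans (inf-greatest _ t≤⋁χ) (≤-trans (y≤x+∣x-y∣ _ _)
          (≤-trans (+-monoˡ-≤ _ (≤-trans (inf-lower c) ⋁χ≤0)) (reflexive (+-identityˡ _))))
        where
        s = proj₁ separable
        φ : ∀ i → Formula L Ω (suc n) (proj₁ (separated (s i)))
        φ i = proj₁ (proj₂ (separated (s i)))
        φ-rank : ∀ i → qr (φ i) ≤ₒ β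
        φ-rank i = proj₁ (proj₂ (proj₂ (separated (s i))))
        t≤gap : ∀ i → t ≤ gap A B (φ i) (a ∷ʳ c) (b ∷ʳ s i)
        t≤gap i = proj₂ (proj₂ (proj₂ (separated (s i))))
        v z : ∀ i → ℝ
        v i = proj₁ (⟦ A ⟧ (φ i) (a ∷ʳ c))
        z i = proj₁ (⟦ B ⟧ (φ i) (b ∷ʳ s i))
        open module Tr i = Truncation t 0≤t (v i) using (truncate; truncate-1-lipschitz; truncate-image)
        T : Interval
        -- The interval is the same for every centre `v i`, so `0#` stands in for the centre and all
        -- `χ i` share one bound, as `⋁` requires.
        T = Truncation.range t 0≤t 0#
        χ : ℕ → Formula L Ω (suc n) T
        χ i = lipschitz (truncate i) (truncate-1-lipschitz i)
          (truncate-image i {proj₁ (separated (s i))} (proj₂ (⟦ A ⟧ (φ i) (a ∷ʳ c)))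
            (proj₂ (⟦ B ⟧ (φ i) (b ∷ʳ s i))) (t≤gap i))
          (λ _ → φ i)
        χ-rank : ∀ i → qr (χ i) ≤ₒ β
        -- The rank of a unary connective is `qr (φ i) ⊔ₒ zero`, a `sup` that is `zero` after its
        -- first term.
        χ-rank i = sup-≤ λ { zero → φ-rank i ; (suc _) → z≤ }
        ⋁χ≤0 : proj₁ (⟦ A ⟧ (⋁ χ) (a ∷ʳ c)) ≤ 0#
        ⋁χ≤0 = proj₂ (proj₂ (complete _ _ _)) 0# λ i → ≤-trans (x⊓y≤y _ _) (∣x-x∣≤0 (v i))
        t≤χᵢ : ∀ i → t ≤ proj₁ (⟦ B ⟧ (χ i) (b ∷ʳ s i))
        t≤χᵢ i = ⊓-glb ≤-refl (≤-trans (t≤gap i) (∣x-y∣≤∣y-x∣ (v i) (z i)))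
        t≤⋁χ : ∀ e → t ≤ proj₁ (⟦ B ⟧ (⋁ χ) (b ∷ʳ e))
        t≤⋁χ e = x≤y+ε⇒x≤y λ ε 0<ε →
          -- `η` must be fixed before `i`, since the formula `χ i` depends on `i`; it can be,
          -- because it comes from Ω alone. The two extensions of b̄ differ only in entry n, so `δ`
          -- is 0 elsewhere.
          let η , 0<η , small = weakModulus-small Ω n ε 0<ε
              i , sᵢ~e        = proj₂ separable e η 0<η
              δ               = (λ _ → 0₊) [ n ≔ d B (s i) e ]
              close           = small (d B (s i) e) sᵢ~e (formula-respects B δ
                (∷ʳ-pointwise (λ k x y → d B x y ≤₊ δ k)
                  (λ j → ≤-trans (d-refl B (b j)) (proj₂ (δ (toℕ j))))
                  (reflexive (Eq.reflexive (cong proj₁ (sym (update-lookup n _))))))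
                (χ i))
          in ≤-trans (t≤χᵢ i) (≤-trans (x≤y+∣x-y∣ _ _) (≤-trans (+-monoʳ-≤ _ close)
               (+-monoˡ-≤ ε (proj₁ (proj₂ (complete _ _ _)) i))))
          where
          update-lookup : ∀ n t → ((λ _ → 0₊) [ n ≔ t ]) n ≡ t
          update-lookup n t with n ≟ n
          ... | yes _  = refl
          ... | no n≢n = contradiction refl n≢n
        inf-lower : ∀ c → proj₁ (⟦ A ⟧ (inf′ (⋁ χ)) a) ≤ proj₁ (⟦ A ⟧ (⋁ χ) (a ∷ʳ c))
        inf-lower = proj₁ (proj₂ (inf-exists _ _ _))
        inf-greatest : ∀ u → (∀ e → u ≤ proj₁ (⟦ B ⟧ (⋁ χ) (b ∷ʳ e))) →
                       u ≤ proj₁ (⟦ B ⟧ (inf′ (⋁ χ)) b)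
        inf-greatest = proj₂ (proj₂ (inf-exists _ _ _))

    -- Equality of the two distances at zero, successor and limit levels

    module _ (Ω : WeakModulus) (A B : Structure L)
      (A-separable : Separable A) (B-separable : Separable B) where

      open BackAndForth Ω A B

      formulaDistance : Ord → Distance
      formulaDistance α n a b =
        ⨆ (λ ((I , φ , _) : Σ[ I ∈ Interval ] Σ[ φ ∈ Formula L Ω n I ] (qr φ ≤ₒ α)) →
             [ ∣ proj₁ (⟦ A ⟧ φ a) - proj₁ (⟦ B ⟧ φ b) ∣₊ ])

      gap-≼ : ∀ {n a b α I} (φ : Formula L Ω n I) → qr φ ≤ₒ α → gap A B φ a b ≼ formulaDistance α n a b
      gap-≼ φ q = ≤∞⇒≼ (≤-⨆ _ (_ , φ , q))

      formulaDistance-≤ : ∀ {n a b α u} →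
        (∀ {I} (φ : Formula L Ω n I) → qr φ ≤ₒ α → gap A B φ a b ≼ u) → formulaDistance α n a b ≤∞ u
      formulaDistance-≤ gap≼u = ⨆-≤ _ λ (_ , φ , q) → ≼⇒≤∞ (gap≼u φ q)

      formulaDistance-mono : ∀ {n a b α β} → α ≤ₒ β → formulaDistance α n a b ≤∞ formulaDistance β n a b
      formulaDistance-mono α≤β = formulaDistance-≤ λ φ q → gap-≼ φ (≤ₒ-trans q α≤β)

      _≈ᵈ_ : Distance → Distance → Set
      r ≈ᵈ r′ = ∀ n a b → r n a b ≈∞ r′ n a b

      -- Zero is recognised only up to `_≈ₒ_`, hence the inequality. No quantified formula has rank
      -- below such an α, so basic formulas bound all gaps.
      r₀-zero : ∀ {α} → α ≤ₒ zero → r₀ ≈ᵈ formulaDistance α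
      r₀-zero α≤0 n a b = TotalOrder.antisym ℝ∞-totalOrder
        (⨆-≤ _ λ (φ , φ-resp , I , φ∈I) → ≼⇒≤∞ (gap-≼ {I = I} (basic φ φ-resp φ∈I) z≤))
        (formulaDistance-≤ (formula-gap A B
          (λ φ φ-resp φ-bounded → ≤∞⇒≼ (≤-⨆ _ (φ , φ-resp , φ-bounded)))
          λ φ q → contradiction (≤ₒ-trans q α≤0) λ ()))

      -- A quantifier costs one move, which bounds the formula gaps. Conversely, if w bounds all
      -- these gaps, every pair of moves has answers within w + ε, as a failure would yield a
      -- formula with gap at least w + ε.
      next-suc : ∀ {α β r} → α ≤ₒ suc β → β <ₒ α → r ≈ᵈ formulaDistance β →
                 next r ≈ᵈ formulaDistance α
      next-suc {α} {β} {r} α≤sβ β<α r≈ n a b = TotalOrder.antisym ℝ∞-totalOrder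
        (⨆-≤ _ λ (c , e) → ≤∞-approx λ w ε 0<ε below-w → choose c e w 0<ε below-w em)
        (formulaDistance-≤ (formula-gap A B basic-gap λ φ q →
          quantifier-gap A B φ
            (λ c t t≤ → forth c λ e → ≤-≼-trans (t≤ e) (gap≼r φ (s≤s⁻¹ (≤ₒ-trans q α≤sβ))))
            (λ e t t≤ → back e λ c → ≤-≼-trans (t≤ c) (gap≼r φ (s≤s⁻¹ (≤ₒ-trans q α≤sβ))))))
        where
        open Max ℝ∞-totalOrder using () renaming (x≤x⊔y to x≤∞x⊔y; x≤y⊔x to x≤∞y⊔x; ⊔-lub to ⊔∞-lub)

        s≤s⁻¹ : ∀ {α β} → suc α ≤ₒ suc β → α ≤ₒ β
        s≤s⁻¹ (s≤s α≤β) = α≤β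

        -- The move in B is a filler: the maximum dominates its first entry, in which only c and its
        -- answer occur. `back` is the mirror image.
        forth : ∀ c {t} → (∀ e → t ≼ r (suc n) (a ∷ʳ c) (b ∷ʳ e)) → t ≼ next r n a b
        forth c t≼ = ≼-≤∞-trans
          (≼-⨅ λ (_ , e′) → ≼-≤∞-trans (t≼ e′) (x≤∞x⊔y _ _))
          (≤-⨆ _ (c , Structure.inhabitant B))

        back : ∀ e {t} → (∀ c → t ≼ r (suc n) (a ∷ʳ c) (b ∷ʳ e)) → t ≼ next r n a b
        back e t≼ = ≼-≤∞-trans
          (≼-⨅ λ (c′ , e′) → ≼-≤∞-trans (t≼ c′) (x≤∞y⊔x (r (suc n) (a ∷ʳ c) (b ∷ʳ e′)) _))
          (≤-⨆ _ (c , e))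
          where c = Structure.inhabitant A

        gap≼r : ∀ {I} (φ : Formula L Ω (suc n) I) {a b} → qr φ ≤ₒ β → gap A B φ a b ≼ r (suc n) a b
        gap≼r φ q = ≼-≤∞-trans (gap-≼ φ q) (≤∞-reflexive (≈∞-sym (r≈ _ _ _)))

        basic-gap : ∀ φ → RespectsModulus Ω φ → ∃[ I ] RespectsBound I φ →
                    ∣ ⟦ A ⟧ᵇ φ a - ⟦ B ⟧ᵇ φ b ∣ ≼ next r n a b
        basic-gap φ φ-resp (I , φ∈I) = forth c λ e → ≤-≼-trans
          (reflexive (∣-∣-cong (Eq.sym (weaken-sound A a c φ)) (Eq.sym (weaken-sound B b e φ))))
          (gap≼r {I} (basic (weaken φ) (weaken-respects Ω φ φ-resp) φ∈I) z≤)
          where c = Structure.inhabitant A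

        separating : ∀ {a b t} → ¬ (r (suc n) a b ≤∞ [ t ]) →
          Σ[ I ∈ Interval ] Σ[ φ ∈ Formula L Ω (suc n) I ] qr φ ≤ₒ β × proj₁ t ≤ gap A B φ a b
        separating {a} {b} {t} r≰t =
          let (I , φ , q) , gap≰t = ¬∀⇒∃¬
                {X = Σ[ I ∈ Interval ] Σ[ φ ∈ Formula L Ω (suc n) I ] qr φ ≤ₒ β}
                {P = λ (_ , φ , _) → gap A B φ a b ≤ proj₁ t}
                λ gap≤t → r≰t (≤∞-trans (≤∞-reflexive (r≈ _ _ _))
                  (formulaDistance-≤ λ φ q → fin (gap≤t (_ , φ , q))))
          in I , φ , q , proj₁ (≰⇒> gap≰t)

        too-far : ∀ {w ε} → 0# < ε → formulaDistance α n a b ≤∞ [ w ] →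
          ¬ (Σ[ I ∈ Interval ] Σ[ ψ ∈ Formula L Ω n I ]
             qr ψ ≤ₒ suc β × proj₁ w + ε ≤ gap A B ψ a b)
        too-far 0<ε ≤w (_ , ψ , q , w+ε≤gap) = <⇒≱ 0<ε (≤-trans
          (≤-trans (reflexive (Eq.sym (xyx⁻¹≈y _ _)))
            (+-monoˡ-≤ _ (≤-trans w+ε≤gap (fin⁻¹ (≼-≤∞-trans (gap-≼ ψ (≤ₒ-trans q β<α)) ≤w)))))
          (reflexive (-‿inverseʳ _)))

        -- The answers decouple: e′ occurs only in the first entry of the maximum and c′ only in the
        -- second. So either both moves have answers within t, which combine, or one move has none
        -- and `distinguish` applies to it.
        choose : ∀ c e w {ε} (0<ε : 0# < ε) → formulaDistance α n a b ≤∞ [ w ] →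
          let t = w +₊ (ε , proj₁ 0<ε)
              F = λ ((c′ , e′) : Carrier A × Carrier B) →
                    r (suc n) (a ∷ʳ c) (b ∷ʳ e′) ⊔∞ r (suc n) (a ∷ʳ c′) (b ∷ʳ e)
          in Dec (⨅ F ≤∞ [ t ]) → ⨅ F ≤∞ [ t ]
        choose c e w     0<ε ≤w (yes ⨅≤t) = ⨅≤t
        choose c e w {ε} 0<ε ≤w (no ⨅≰t)
          with em {∃[ e′ ] r (suc n) (a ∷ʳ c) (b ∷ʳ e′) ≤∞ [ w +₊ (ε , proj₁ 0<ε) ]}
             | em {∃[ c′ ] r (suc n) (a ∷ʳ c′) (b ∷ʳ e) ≤∞ [ w +₊ (ε , proj₁ 0<ε) ]}
        ... | yes (e′ , r≤t) | yes (c′ , r′≤t) =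
          contradiction (≤∞-trans (⨅-≤ _ (c′ , e′)) (⊔∞-lub r≤t r′≤t)) ⨅≰t
        ... | no r≰t | _ = contradiction
          (distinguish A B B-separable c (proj₂ t) λ e′ → separating λ r≤t → r≰t (e′ , r≤t))
          (too-far 0<ε ≤w)
          where t = w +₊ (ε , proj₁ 0<ε)
        -- The same argument with A and B exchanged; gaps are reversed on the way in and on the way
        -- out.
        ... | _ | no r≰t = contradiction
          (map₂ (λ (ψ , q , t≤) → ψ , q , ≤-trans t≤ (∣x-y∣≤∣y-x∣ _ _))
            (distinguish B A A-separable e (proj₂ t) λ c′ →
              map₂ (λ (φ , q , t≤) → φ , q , ≤-trans t≤ (∣x-y∣≤∣y-x∣ _ _))
                (separating λ r≤t → r≰t (c′ , r≤t))))
          (too-far 0<ε ≤w)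
          where t = w +₊ (ε , proj₁ 0<ε)

      -- A countable connective may have rank exactly α, but `formula-gap` descends through it to
      -- basic and quantified formulas. Those have rank zero or a successor, hence lie strictly
      -- below the limit α.
      ⨆-limit : ∀ {α} {rec : ∀ {β} → β <ₒ α → Distance} →
        ¬ (α ≈ₒ zero) → ¬ (∃[ β ] α ≈ₒ suc β) →
        (∀ {β} (β<α : β <ₒ α) → rec β<α ≈ᵈ formulaDistance β) →
        (λ n a b → ⨆ (λ ((β , β<α) : ∃[ β ] β <ₒ α) → rec β<α n a b)) ≈ᵈ formulaDistance α
      ⨆-limit {α} {rec} α≉0 α≉suc rec≈ n a b = TotalOrder.antisym ℝ∞-totalOrder
        (⨆-≤ _ λ (β , β<α) → ≤∞-trans (≤∞-reflexive (rec≈ β<α n a b))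
          (formulaDistance-mono (≤ₒ-trans ≤ₒ-suc β<α)))
        (formulaDistance-≤ (formula-gap A B
          (λ φ φ-resp (I , φ∈I) → below-limit {I} (basic φ φ-resp φ∈I) 0<α)
          λ φ q → below-limit (inf′ φ) (suc<α q) , below-limit (sup′ φ) (suc<α q)))
        where
        below-limit : ∀ {I} (φ : Formula L Ω n I) → qr φ <ₒ α →
          gap A B φ a b ≼ ⨆ (λ ((β , β<α) : ∃[ β ] β <ₒ α) → rec β<α n a b)
        below-limit φ q = ≼-≤∞-trans (gap-≼ φ ≤ₒ-refl)
          (≤∞-trans (≤∞-reflexive (≈∞-sym (rec≈ q n a b))) (≤-⨆ _ (_ , q)))
        0<α : zero <ₒ α
        0<α with ≤ₒ-<ₒ-connex α zero
        ... | inj₁ α≤0 = contradiction (α≤0 , z≤) α≉0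
        ... | inj₂ 0<α = 0<α
        suc<α : ∀ {β} → β <ₒ α → suc β <ₒ α
        suc<α {β} β<α with ≤ₒ-<ₒ-connex α (suc β)
        ... | inj₁ α≤sβ = contradiction (β , α≤sβ , β<α) α≉suc
        ... | inj₂ sβ<α = sβ<α

      step-correct : ∀ {α} {rec : ∀ {β} → β <ₒ α → Distance} →
        (∀ {β} (β<α : β <ₒ α) → rec β<α ≈ᵈ formulaDistance β) →
        ∀ zero? suc? → step α rec zero? suc? ≈ᵈ formulaDistance α
      step-correct rec≈ (yes (α≤0 , _)) _ = r₀-zero α≤0
      step-correct rec≈ (no _) (yes (β , α≤sβ , β<α)) = next-suc α≤sβ β<α (rec≈ β<α)
      step-correct {rec = rec} rec≈ (no α≉0) (no α≉suc) = ⨆-limit {rec = rec} α≉0 α≉suc rec≈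

      -- Quantifying over the accessibility proof lets the induction follow the recursion of `r-acc`
      -- without comparing two such proofs.
      r-acc-correct : ∀ {α} (α-acc : Acc _<ₒ_ α) → r-acc α α-acc ≈ᵈ formulaDistance α
      r-acc-correct (acc rs) = step-correct (λ β<α → r-acc-correct (rs β<α)) em em

theorem1p1 : (em : ExcludedMiddle 0ℓ) (R : CompleteOrderedField) →
    let open MetricLogic em R in
    (L : Signature) → Countable L → (Ω : WeakModulus) →
    (A B : Structure L) → Separable A → Separable B →
    (n : ℕ) (a : Fin n → Structure.Carrier A) (b : Fin n → Structure.Carrier B) →
    (α : Ord) →
    BackAndForth.r Ω A B α n a b
    ≈∞ ⨆ (λ ((I , φ , _) : Σ[ I ∈ Interval ] Σ[ φ ∈ Formula L Ω n I ] (qr φ ≤ₒ α)) →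
    [ ∣ proj₁ (⟦ A ⟧ φ a) - proj₁ (⟦ B ⟧ φ b) ∣₊ ])
theorem1p1 em R L _ Ω A B A-separable B-separable n a b α =
  Interpretations.r-acc-correct em R Ω A B A-separable B-separable (<ₒ-wellFounded α) n a b
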